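{- Let $k\ge 0$ be an integer and $n=2^{k+3}$. Then there exist two trees $T_1,T_2$ of order $n$ that are incomparable with respect to $\preceq$, i.e. neither $T_1\preceq T_2$ nor $T_2\preceq T_1$ holds.
   Context: All graphs are finite, simple and undirected. The independence polynomial of a graph $G$ is $I(G,x)=\sum_{k\ge 0} i_kx^k$, where $i_k$ is the number of independent sets of size $k$ in $G$. It is known that the root of $I(G,x)$ of smallest modulus is real and lies in $[-1,0)$; it is denoted $\xi(G)$ (equivalently, the largest real root of $I(G,x)$). For graphs $G,H$, write $H\preceq G$ if and only if $I(H,x)\ge I(G,x)$ for all $x\in[\xi(G),0]$. -}

module Defs where

open import Algebra.Bundles.Raw using (RawSemiring)
open import Data.Bool.Base using (true; false)
open import Data.Fin.Base using (Fin; zero; suc; toℕ; fromℕ; inject₁)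
open import Data.Fin.Properties using (all?)
open import Data.Fin.Subset using (Subset; _∈_; ∣_∣)
open import Data.Fin.Subset.Properties using (_∈?_)
open import Data.List.Base as List using (List; []; _∷_; _++_; filter; length)
open import Data.Nat.Base as ℕ using (ℕ; zero; suc)
import Data.Nat.Properties as ℕ
open import Data.Product.Base using (_×_; _,_; ∃-syntax)
open import Data.Rational.Base as ℚ using (ℚ; 0ℚ; 1ℚ; ½)
import Data.Rational.Properties as ℚ
open import Data.Rational.Solver using (module +-*-Solver)
open import Data.Vec.Base as Vec using ([]; _∷_)
open import Function.Base using (_∘_)
open import Function.Definitions using (Injective)
open import Level using (0ℓ)
open import Relation.Binary.Construct.Closure.ReflexiveTransitive using (Star)
open import Relation.Binary.Core using (Rel)
open import Relation.Binary.Definitions using (Decidable; Symmetric)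
open import Relation.Binary.PropositionalEquality
open import Relation.Nullary.Decidable using (Dec; ¬?; _→-dec_; _×-dec_)
open import Relation.Nullary.Negation using (¬_)

infix  4 _≈_ _≤_ _⪯_
infixl 6 _+_
infixl 7 _*_

------------------------------------------------------------------------
-- Real numbers

-- A real is represented by a Cauchy sequence of rationals; equality of
-- reals is _≈_ below, not propositional equality of sequences.

IsCauchy : (ℕ → ℚ) → Set
IsCauchy x = ∀ ε → 0ℚ ℚ.< ε →
  ∃[ N ] (∀ m n → N ℕ.≤ m → N ℕ.≤ n → ℚ.∣ x m ℚ.- x n ∣ ℚ.< ε)

record ℝ : Set where
  constructor mkℝ
  field
    seq    : ℕ → ℚ
    cauchy : IsCauchy seq

open ℝ public

_≈_ : Rel ℝ 0ℓ
x ≈ y = ∀ ε → 0ℚ ℚ.< ε →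
  ∃[ N ] (∀ n → N ℕ.≤ n → ℚ.∣ seq x n ℚ.- seq y n ∣ ℚ.< ε)

-- The slack ε makes this the non-strict order on limits; it respects _≈_.

_≤_ : Rel ℝ 0ℓ
x ≤ y = ∀ ε → 0ℚ ℚ.< ε →
  ∃[ N ] (∀ n → N ℕ.≤ n → seq x n ℚ.≤ seq y n ℚ.+ ε)

private
  half-pos : ∀ {ε} → 0ℚ ℚ.< ε → 0ℚ ℚ.< ½ ℚ.* ε
  half-pos {ε} 0<ε = subst (ℚ._< ½ ℚ.* ε) (ℚ.*-zeroʳ ½) (ℚ.*-monoʳ-<-pos ½ 0<ε)

  half+half : ∀ ε → ½ ℚ.* ε ℚ.+ ½ ℚ.* ε ≡ ε
  half+half ε = trans (sym (ℚ.*-distribʳ-+ ε ½ ½)) (ℚ.*-identityˡ ε)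

  const-cauchy : ∀ q → IsCauchy (λ _ → q)
  const-cauchy q ε 0<ε =
    0 , λ _ _ _ _ → subst (λ d → ℚ.∣ d ∣ ℚ.< ε) (sym (ℚ.+-inverseʳ q)) 0<ε

  +-cauchy : ∀ {x y} → IsCauchy x → IsCauchy y → IsCauchy (λ n → x n ℚ.+ y n)
  +-cauchy {x} {y} cx cy ε 0<ε
    with cx (½ ℚ.* ε) (half-pos 0<ε) | cy (½ ℚ.* ε) (half-pos 0<ε)
  ... | N , p | M , q = N ℕ.⊔ M , λ m n N≤m N≤n → begin-strict
    ℚ.∣ (x m ℚ.+ y m) ℚ.- (x n ℚ.+ y n) ∣
      ≡⟨ cong ℚ.∣_∣ (rearrange (x m) (y m) (x n) (y n)) ⟩
    ℚ.∣ (x m ℚ.- x n) ℚ.+ (y m ℚ.- y n) ∣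
      ≤⟨ ℚ.∣p+q∣≤∣p∣+∣q∣ (x m ℚ.- x n) (y m ℚ.- y n) ⟩
    ℚ.∣ x m ℚ.- x n ∣ ℚ.+ ℚ.∣ y m ℚ.- y n ∣
      <⟨ ℚ.+-mono-< (p m n (ℕ.m⊔n≤o⇒m≤o N M N≤m) (ℕ.m⊔n≤o⇒m≤o N M N≤n))
                    (q m n (ℕ.m⊔n≤o⇒n≤o N M N≤m) (ℕ.m⊔n≤o⇒n≤o N M N≤n)) ⟩
    ½ ℚ.* ε ℚ.+ ½ ℚ.* ε
      ≡⟨ half+half ε ⟩
    ε ∎
    where
    open ℚ.≤-Reasoning
    open +-*-Solver
    rearrange : ∀ a b c d → (a ℚ.+ b) ℚ.- (c ℚ.+ d) ≡ (a ℚ.- c) ℚ.+ (b ℚ.- d)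
    rearrange = solve 4 (λ a b c d → (a :+ b) :- (c :+ d) := (a :- c) :+ (b :- d)) refl

  cauchy⇒bounded : ∀ {x} → IsCauchy x →
    ∃[ B ] (0ℚ ℚ.< B × ∃[ N ] (∀ n → N ℕ.≤ n → ℚ.∣ x n ∣ ℚ.≤ B))
  cauchy⇒bounded {x} cx with cx 1ℚ (ℚ.positive⁻¹ 1ℚ)
  ... | N , p = 1ℚ ℚ.+ ℚ.∣ x N ∣
              , ℚ.+-mono-<-≤ (ℚ.positive⁻¹ 1ℚ) (ℚ.0≤∣p∣ (x N))
              , N , λ n N≤n → begin
    ℚ.∣ x n ∣                       ≡⟨ cong ℚ.∣_∣ (split (x n) (x N)) ⟩
    ℚ.∣ (x n ℚ.- x N) ℚ.+ x N ∣     ≤⟨ ℚ.∣p+q∣≤∣p∣+∣q∣ (x n ℚ.- x N) (x N) ⟩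
    ℚ.∣ x n ℚ.- x N ∣ ℚ.+ ℚ.∣ x N ∣ ≤⟨ ℚ.+-monoˡ-≤ ℚ.∣ x N ∣ (ℚ.<⇒≤ (p n N N≤n ℕ.≤-refl)) ⟩
    1ℚ ℚ.+ ℚ.∣ x N ∣                ∎
    where
    open ℚ.≤-Reasoning
    open +-*-Solver
    split : ∀ a b → a ≡ (a ℚ.- b) ℚ.+ b
    split = solve 2 (λ a b → a := (a :- b) :+ b) refl

  -- For every ε > 0 and B > 0 there is δ > 0 with B δ = ε.
  scale : ∀ {B ε} → 0ℚ ℚ.< B → 0ℚ ℚ.< ε → ∃[ δ ] (0ℚ ℚ.< δ × B ℚ.* δ ≡ ε)
  scale {B} {ε} 0<B 0<ε =
    1/B ℚ.* ε , subst (ℚ._< 1/B ℚ.* ε) (ℚ.*-zeroʳ 1/B) (ℚ.*-monoʳ-<-pos 1/B 0<ε)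
              , trans (sym (ℚ.*-assoc B 1/B ε))
                      (trans (cong (ℚ._* ε) (ℚ.*-inverseʳ B)) (ℚ.*-identityˡ ε))
    where
    instance
      B-pos = ℚ.positive 0<B
      B-nonZero = ℚ.pos⇒nonZero B
    1/B = ℚ.1/ B
    instance
      1/B-pos = ℚ.1/pos⇒pos B

  ∣*∣-bound : ∀ p q {B δ} → ℚ.∣ p ∣ ℚ.≤ B → 0ℚ ℚ.< B → ℚ.∣ q ∣ ℚ.< δ →
    ℚ.∣ p ℚ.* q ∣ ℚ.< B ℚ.* δ
  ∣*∣-bound p q {B} {δ} p≤B 0<B q<δ = begin-strict
    ℚ.∣ p ℚ.* q ∣       ≡⟨ ℚ.∣p*q∣≡∣p∣*∣q∣ p q ⟩
    ℚ.∣ p ∣ ℚ.* ℚ.∣ q ∣ ≤⟨ ℚ.*-monoʳ-≤-nonNeg ℚ.∣ q ∣ {{ℚ.∣-∣-nonNeg q}} p≤B ⟩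
    B ℚ.* ℚ.∣ q ∣       <⟨ ℚ.*-monoʳ-<-pos B {{ℚ.positive 0<B}} q<δ ⟩
    B ℚ.* δ             ∎
    where open ℚ.≤-Reasoning

  *-close : ∀ a b c d {B C δ η} → 0ℚ ℚ.< B → 0ℚ ℚ.< C →
    ℚ.∣ a ∣ ℚ.≤ B → ℚ.∣ d ∣ ℚ.≤ C → ℚ.∣ b ℚ.- d ∣ ℚ.< δ → ℚ.∣ a ℚ.- c ∣ ℚ.< η →
    ℚ.∣ a ℚ.* b ℚ.- c ℚ.* d ∣ ℚ.< B ℚ.* δ ℚ.+ C ℚ.* η
  *-close a b c d {B} {C} {δ} {η} 0<B 0<C a≤B d≤C b-d<δ a-c<η = begin-strict
    ℚ.∣ a ℚ.* b ℚ.- c ℚ.* d ∣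
      ≡⟨ cong ℚ.∣_∣ (rearrange a b c d) ⟩
    ℚ.∣ a ℚ.* (b ℚ.- d) ℚ.+ d ℚ.* (a ℚ.- c) ∣
      ≤⟨ ℚ.∣p+q∣≤∣p∣+∣q∣ (a ℚ.* (b ℚ.- d)) (d ℚ.* (a ℚ.- c)) ⟩
    ℚ.∣ a ℚ.* (b ℚ.- d) ∣ ℚ.+ ℚ.∣ d ℚ.* (a ℚ.- c) ∣
      <⟨ ℚ.+-mono-< {ℚ.∣ a ℚ.* (b ℚ.- d) ∣} {B ℚ.* δ} {ℚ.∣ d ℚ.* (a ℚ.- c) ∣} {C ℚ.* η}
           (∣*∣-bound a (b ℚ.- d) a≤B 0<B b-d<δ)
           (∣*∣-bound d (a ℚ.- c) d≤C 0<C a-c<η) ⟩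
    B ℚ.* δ ℚ.+ C ℚ.* η ∎
    where
    open ℚ.≤-Reasoning
    open +-*-Solver
    rearrange : ∀ a b c d →
      a ℚ.* b ℚ.- c ℚ.* d ≡ a ℚ.* (b ℚ.- d) ℚ.+ d ℚ.* (a ℚ.- c)
    rearrange = solve 4 (λ a b c d →
      a :* b :- c :* d := a :* (b :- d) :+ d :* (a :- c)) refl

  *-cauchy : ∀ {x y} → IsCauchy x → IsCauchy y → IsCauchy (λ n → x n ℚ.* y n)
  *-cauchy {x} {y} cx cy ε 0<ε =
    let B , 0<B , N₁ , bx = cauchy⇒bounded cx
        C , 0<C , N₂ , by = cauchy⇒bounded cy
        δ , 0<δ , Bδ≡½ε = scale 0<B (half-pos 0<ε)
        η , 0<η , Cη≡½ε = scale 0<C (half-pos 0<ε)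
        N₃ , p = cy δ 0<δ
        N₄ , q = cx η 0<η
        N₁₂ = N₁ ℕ.⊔ N₂
        N₃₄ = N₃ ℕ.⊔ N₄
        ≥₁₂ : ∀ {k} → N₁₂ ℕ.⊔ N₃₄ ℕ.≤ k → N₁₂ ℕ.≤ k
        ≥₁₂ = ℕ.m⊔n≤o⇒m≤o N₁₂ N₃₄
        ≥₃₄ : ∀ {k} → N₁₂ ℕ.⊔ N₃₄ ℕ.≤ k → N₃₄ ℕ.≤ k
        ≥₃₄ = ℕ.m⊔n≤o⇒n≤o N₁₂ N₃₄
        Bδ+Cη≡ε = trans (cong₂ ℚ._+_ Bδ≡½ε Cη≡½ε) (half+half ε)
    in N₁₂ ℕ.⊔ N₃₄ , λ m n N≤m N≤n →
      subst (ℚ.∣ x m ℚ.* y m ℚ.- x n ℚ.* y n ∣ ℚ.<_) Bδ+Cη≡ε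
        (*-close (x m) (y m) (x n) (y n) 0<B 0<C
          (bx m (ℕ.m⊔n≤o⇒m≤o N₁ N₂ (≥₁₂ N≤m)))
          (by n (ℕ.m⊔n≤o⇒n≤o N₁ N₂ (≥₁₂ N≤n)))
          (p m n (ℕ.m⊔n≤o⇒m≤o N₃ N₄ (≥₃₄ N≤m)) (ℕ.m⊔n≤o⇒m≤o N₃ N₄ (≥₃₄ N≤n)))
          (q m n (ℕ.m⊔n≤o⇒n≤o N₃ N₄ (≥₃₄ N≤m)) (ℕ.m⊔n≤o⇒n≤o N₃ N₄ (≥₃₄ N≤n))))

fromℚ : ℚ → ℝ
fromℚ q = mkℝ (λ _ → q) (const-cauchy q)

0ℝ 1ℝ : ℝ
0ℝ = fromℚ 0ℚ
1ℝ = fromℚ 1ℚ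

_+_ _*_ : ℝ → ℝ → ℝ
x + y = mkℝ (λ n → seq x n ℚ.+ seq y n) (+-cauchy {seq x} {seq y} (cauchy x) (cauchy y))
x * y = mkℝ (λ n → seq x n ℚ.* seq y n) (*-cauchy {seq x} {seq y} (cauchy x) (cauchy y))

ℝ-rawSemiring : RawSemiring 0ℓ 0ℓ
ℝ-rawSemiring = record
  { Carrier = ℝ ; _≈_ = _≈_ ; _+_ = _+_ ; _*_ = _*_ ; 0# = 0ℝ ; 1# = 1ℝ }

-- k · x is the k-fold sum of x.
open import Algebra.Definitions.RawSemiring ℝ-rawSemiring public
  using (sum; _^_) renaming (_×_ to _·_)

------------------------------------------------------------------------
-- Graphs and trees

record Graph (n : ℕ) : Set₁ where
  field
    Adj     : Rel (Fin n) 0ℓ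
    adj?    : Decidable Adj
    adj-sym : Symmetric Adj
    no-loop : ∀ v → ¬ Adj v v

open Graph public

Connected : ∀ {n} → Graph n → Set
Connected G = ∀ u v → Star (Adj G) u v

-- A cycle v₀ v₁ … vₗ₋₁ v₀ on ℓ = 3 + m distinct vertices.

record Cycle {n} (G : Graph n) : Set where
  field
    m         : ℕ
    vertex    : Fin (3 ℕ.+ m) → Fin n
    distinct  : Injective _≡_ _≡_ vertex
    step      : ∀ (i : Fin (2 ℕ.+ m)) → Adj G (vertex (inject₁ i)) (vertex (suc i))
    closing   : Adj G (vertex (fromℕ (2 ℕ.+ m))) (vertex zero)

record IsTree {n} (G : Graph n) : Set where
  field
    nonempty  : 0 ℕ.< n
    connected : Connected G
    acyclic   : ¬ Cycle G

------------------------------------------------------------------------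
-- Independence polynomial

Independent : ∀ {n} → Graph n → Subset n → Set
Independent G S = ∀ u v → u ∈ S → v ∈ S → ¬ Adj G u v

independent? : ∀ {n} (G : Graph n) (S : Subset n) → Dec (Independent G S)
independent? G S = all? λ u → all? λ v →
  (u ∈? S) →-dec ((v ∈? S) →-dec ¬? (adj? G u v))

-- Every subset of Fin n, listed exactly once.

subsets : ∀ n → List (Subset n)
subsets zero    = [] ∷ []
subsets (suc n) = List.map (true ∷_) (subsets n) ++ List.map (false ∷_) (subsets n)

indepCount : ∀ {n} → Graph n → ℕ → ℕ
indepCount {n} G k =
  length (filter (λ S → (∣ S ∣ ℕ.≟ k) ×-dec independent? G S) (subsets n))

-- The sum stops at k = n because no subset of Fin n has more elements.

I : ∀ {n} → Graph n → ℝ → ℝ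
I {n} G x = sum {suc n} λ k → indepCount G (toℕ k) · x ^ toℕ k

-- IsLargestRoot G r says r = ξ(G).

IsLargestRoot : ∀ {n} → Graph n → ℝ → Set
IsLargestRoot G r = I G r ≈ 0ℝ × (∀ s → I G s ≈ 0ℝ → s ≤ r)

-- ξ(G) exists and is unique up to _≈_, so quantifying over all ξ that are
-- the largest root of G refers to ξ(G) itself.

_⪯_ : ∀ {m n} → Graph m → Graph n → Set
H ⪯ G = ∀ ξ → IsLargestRoot G ξ → ∀ x → ξ ≤ x → x ≤ 0ℝ → I G x ≤ I H x

{-# OPTIONS --safe #-}

-- Attaching a leaf to every vertex of a tree turns its independence polynomial I(x), on n
-- vertices, into (1 + x)ⁿ I(x / (1 + x)). The substitution is increasing, so it preserves
-- the signs of I and of differences of such polynomials, and it moves - 1 / t to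
-- - 1 / (t + 1). Hence it preserves incomparability, and it is enough to find one
-- incomparable pair on 8 vertices: 1 + 8x + 21x² + 22x³ + 8x⁴ and
-- 1 + 8x + 21x² + 23x³ + 13x⁴ + 3x⁵. Both largest roots lie in [- 2/7 , - 1/4]; the first
-- polynomial is smaller than the second at - 1/4 and larger at - 1/5.
--
-- The largest root of each polynomial is constructed by bisection, which needs that the
-- polynomial increases strictly wherever it is nonnegative to the right of the left endpoint.

module Submission where

open import Data.Nat using (ℕ; _+_; _^_)
open import Data.Product using (_×_; Σ-syntax)
open import Relation.Nullary using (¬_)
open import Defs using (Graph; IsTree; _⪯_)

open import Algebra.Bundles using (CommutativeRing)
open import Algebra.Core using (Op₂)
open import Data.Bool.Base using (Bool; true; false; if_then_else_; not; _∧_)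
open import Data.Empty using (⊥)
open import Data.Fin.Base using (Fin; zero; suc; toℕ; fromℕ; inject₁; punchOut)
open import Data.Fin.Patterns using (4F; 5F; 6F)
import Data.Fin.Properties as Fin
open import Data.Fin.Relation.Unary.Top using (view; ‵fromℕ; ‵inject₁)
open import Data.Fin.Subset using (Subset; _∈_; _∉_; ∣_∣)
open import Data.Fin.Subset.Properties using (∣p∣≤n)
open import Data.Integer.Base as ℤ using (+_; -[1+_])
import Data.Integer.Properties as ℤ
open import Data.List.Base as List using (List; []; _∷_; _++_; filter; length)
open import Data.Nat.Base as ℕ using (zero; suc)
import Data.Nat.Properties as ℕ
open import Data.Product.Base using (_,_; proj₁; proj₂; ∃-syntax)
open import Data.Rational.Base as ℚ using (ℚ; 0ℚ; 1ℚ; ½; _/_; mkℚ; toℚᵘ)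
import Data.Rational.Properties as ℚ
open import Data.Rational.Solver using (module +-*-Solver)
open import Data.Rational.Unnormalised.Base as ℚᵘ using (mkℚᵘ; *≡*)
import Data.Rational.Unnormalised.Properties as ℚᵘ
open import Data.Sum.Base using (_⊎_; inj₁; inj₂)
open import Data.Vec.Base as Vec using (Vec; []; _∷_; here; there; updateAt; replicate; lookup)
open import Data.Vec.Properties using ([]=⇒lookup; lookup⇒[]=)
open import Data.Vec.Relation.Unary.All using (All; []; _∷_; all?)
open import Function.Base using (_∘_)
open import Function.Bundles using (mk⇔)
open import Level using (0ℓ)
open import Relation.Binary.Construct.Closure.ReflexiveTransitive as Star
  using (Star; _◅_; _◅◅_; gmap; reverse)
open import Relation.Binary.PropositionalEquality
open import Relation.Nullary.Decidable
  using (Dec; yes; no; does; does-⇔; dec-false; from-yes; _×-dec_)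
open import Relation.Nullary.Negation using (contradiction)
open import Relation.Unary using (Pred; Decidable)
open import Algebra.Definitions.RawSemiring ℚ.+-*-rawSemiring
  using () renaming (_×_ to _·_; _^_ to _^ℚ_)
open import Algebra.Properties.CommutativeMonoid.Sum
  (CommutativeRing.+-commutativeMonoid ℚ.+-*-commutativeRing)
  using (sum; ∑-distrib-+; sum-cong-≗; sum-replicate-zero)
open import Algebra.Properties.CommutativeSemiring.Exp
  (CommutativeRing.commutativeSemiring ℚ.+-*-commutativeRing) using (^-distrib-*)
open import Defs as D using
  ( ℝ; seq; cauchy; mkℝ; fromℚ; IsCauchy; Adj; adj?; adj-sym; no-loop; Connected; Cycle
  ; Independent; independent?; subsets; indepCount; I; IsLargestRoot)

private variable
  n : ℕ

-- Trees built leaf by leaf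

-- Trees as iterated pendant vertices; the newest vertex is zero.
data Code : ℕ → Set where
  single  : Code 1
  pendant : ∀ {n} → Fin n → Code n → Code (suc n)

data PendantAdj (v : Fin n) (R : Fin n → Fin n → Set) : Fin (suc n) → Fin (suc n) → Set where
  leafˡ : PendantAdj v R zero (suc v)
  leafʳ : PendantAdj v R (suc v) zero
  old   : ∀ {i j} → R i j → PendantAdj v R (suc i) (suc j)

addPendant : Fin n → Graph n → Graph (suc n)
addPendant {n} v G = record
  { Adj = PendantAdj v (Adj G) ; adj? = dec ; adj-sym = symm ; no-loop = irr }
  where
  dec : ∀ i j → Dec (PendantAdj v (Adj G) i j)
  dec zero zero = no λ ()
  dec zero (suc j) with v Fin.≟ j
  ... | yes refl = yes leafˡ
  ... | no v≢j   = no λ { leafˡ → v≢j refl }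
  dec (suc i) zero with v Fin.≟ i
  ... | yes refl = yes leafʳ
  ... | no v≢i   = no λ { leafʳ → v≢i refl }
  dec (suc i) (suc j) with adj? G i j
  ... | yes a = yes (old a)
  ... | no ¬a = no λ { (old a) → ¬a a }
  symm : ∀ {i j} → PendantAdj v (Adj G) i j → PendantAdj v (Adj G) j i
  symm leafˡ   = leafʳ
  symm leafʳ   = leafˡ
  symm (old a) = old (adj-sym G a)
  irr : ∀ i → ¬ PendantAdj v (Adj G) i i
  irr (suc i) (old a) = no-loop G i a

graph : Code n → Graph n
graph single = record
  { Adj = λ _ _ → ⊥ ; adj? = λ _ _ → no λ () ; adj-sym = λ () ; no-loop = λ _ () }
graph (pendant v c) = addPendant v (graph c)

addPendant-connected : ∀ (v : Fin n) (G : Graph n) → Connected G → Connected (addPendant v G)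
addPendant-connected v G conn i j = toRoot i ◅◅ reverse (adj-sym (addPendant v G)) (toRoot j)
  where
  toRoot : ∀ i → Star (PendantAdj v (Adj G)) i (suc v)
  toRoot zero    = leafˡ ◅ Star.ε
  toRoot (suc i) = gmap suc old (conn i v)

module _ {G : Graph n} (C : Cycle G) where
  open Cycle C

  cycleNeighbours : ∀ i → ∃[ j ] ∃[ k ] (j ≢ k × Adj G (vertex j) (vertex i) × Adj G (vertex i) (vertex k))
  cycleNeighbours zero    = fromℕ (2 ℕ.+ m) , suc zero , (λ ()) , closing , step zero
  cycleNeighbours (suc j) with view j
  ... | ‵fromℕ      = inject₁ (fromℕ (suc m)) , zero , (λ ()) , step (fromℕ (suc m)) , closing
  ... | ‵inject₁ j′ =
    inject₁ (inject₁ j′) , suc (suc j′) , j′≢2+j′ , step (inject₁ j′) , step (suc j′)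
    where
    j′≢2+j′ : inject₁ (inject₁ j′) ≢ suc (suc j′)
    j′≢2+j′ eq = ℕ.<⇒≢ (ℕ.m<n⇒m<1+n (ℕ.n<1+n (toℕ j′)))
      (trans (sym (trans (Fin.toℕ-inject₁ (inject₁ j′)) (Fin.toℕ-inject₁ j′))) (cong toℕ eq))

-- The two neighbours of a vertex on a cycle are distinct, so a cycle cannot pass through a leaf.
addPendant-acyclic : ∀ (v : Fin n) (G : Graph n) → ¬ Cycle G → ¬ Cycle (addPendant v G)
addPendant-acyclic {n} v G acyc C with Fin.any? (λ i → Cycle.vertex C i Fin.≟ zero)
... | yes (i , vi≡0) =
  let j , k , j≢k , j~i , i~k = cycleNeighbours C i
  in j≢k (distinct (trans (fromLeaf (subst (PendantAdj v (Adj G) (vertex j)) vi≡0 j~i))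
                  (sym (toLeaf (subst (λ x → PendantAdj v (Adj G) x (vertex k)) vi≡0 i~k)))))
  where
  open Cycle C
  fromLeaf : ∀ {x} → PendantAdj v (Adj G) x zero → x ≡ suc v
  fromLeaf leafʳ = refl
  toLeaf : ∀ {x} → PendantAdj v (Adj G) zero x → x ≡ suc v
  toLeaf leafˡ = refl
-- A cycle that misses the leaf has only vertices of the form `suc i`; removing `suc` gives a cycle
-- of `G`.
... | no ∄zero = acyc record
  { m        = m
  ; vertex   = below
  ; distinct = λ {i} {j} eq → distinct (trans (sym (suc-below i)) (trans (cong suc eq) (suc-below j)))
  ; step     = λ i → lower (step i)
  ; closing  = lower closing
  }
  where
  open Cycle C
  0≢vertex : ∀ i → zero ≢ vertex i
  0≢vertex i eq = ∄zero (i , sym eq)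
  below : Fin (3 ℕ.+ m) → Fin n
  below i = punchOut (0≢vertex i)
  suc-below : ∀ i → suc (below i) ≡ vertex i
  suc-below i = Fin.punchIn-punchOut (0≢vertex i)
  old⁻¹ : ∀ {i j} → PendantAdj v (Adj G) (suc i) (suc j) → Adj G i j
  old⁻¹ (old a) = a
  lower : ∀ {i j} → PendantAdj v (Adj G) (vertex i) (vertex j) → Adj G (below i) (below j)
  lower {i} {j} a = old⁻¹ (subst₂ (PendantAdj v (Adj G)) (sym (suc-below i)) (sym (suc-below j)) a)

code-isTree : (c : Code n) → IsTree (graph c)
code-isTree single = record
  { nonempty  = ℕ.z<s
  ; connected = λ { zero zero → Star.ε }
  ; acyclic   = λ C → Cycle.closing C
  }
code-isTree (pendant v c) = record
  { nonempty  = ℕ.z<s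
  ; connected = addPendant-connected v (graph c) (IsTree.connected (code-isTree c))
  ; acyclic   = addPendant-acyclic v (graph c) (IsTree.acyclic (code-isTree c))
  }

-- Leaf elimination for the independence polynomial with vertex weights

-- The operations are parameters because the same recursion is later run on the ring solver's
-- symbolic polynomials, which makes the expansions of the two small trees solver calls.
module Elimination {X : Set} (_⊕_ _⊗_ : Op₂ X) where

  -- A weight (a , b) contributes a when its vertex is chosen and b otherwise.
  -- Deleting a leaf of weight w turns the weight of its neighbour into merge w.
  merge : X × X → X × X → X × X
  merge (a₀ , b₀) (a , b) = b₀ ⊗ a , (a₀ ⊕ b₀) ⊗ b

  eliminate : Code n → Vec (X × X) n → X
  eliminate single        ((a , b) ∷ []) = a ⊕ b
  eliminate (pendant v c) (w ∷ ws)       = eliminate c (updateAt ws v (merge w))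

  eliminateConst : Code n → X × X → X
  eliminateConst {n} c p = eliminate c (replicate n p)

open Elimination ℚ._+_ ℚ._*_

weight : Vec (ℚ × ℚ) n → Subset n → ℚ
weight []             []          = 1ℚ
weight ((a , b) ∷ ws) (true ∷ S)  = a ℚ.* weight ws S
weight ((a , b) ∷ ws) (false ∷ S) = b ℚ.* weight ws S

∑ : ∀ {A : Set} → List A → (A → ℚ) → ℚ
∑ []       g = 0ℚ
∑ (x ∷ xs) g = g x ℚ.+ ∑ xs g

module _ {A : Set} where

  ∑-cong : ∀ (xs : List A) {f g : A → ℚ} → (∀ x → f x ≡ g x) → ∑ xs f ≡ ∑ xs g
  ∑-cong []       eq = refl
  ∑-cong (x ∷ xs) eq = cong₂ ℚ._+_ (eq x) (∑-cong xs eq)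

  ∑-++ : ∀ (xs ys : List A) g → ∑ (xs ++ ys) g ≡ ∑ xs g ℚ.+ ∑ ys g
  ∑-++ []       ys g = sym (ℚ.+-identityˡ (∑ ys g))
  ∑-++ (x ∷ xs) ys g = trans (cong (g x ℚ.+_) (∑-++ xs ys g)) (sym (ℚ.+-assoc (g x) _ _))

  ∑-map : ∀ {B : Set} (f : B → A) xs g → ∑ (List.map f xs) g ≡ ∑ xs (g ∘ f)
  ∑-map f []       g = refl
  ∑-map f (x ∷ xs) g = cong (g (f x) ℚ.+_) (∑-map f xs g)

  ∑-+ : ∀ (xs : List A) f g → ∑ xs (λ x → f x ℚ.+ g x) ≡ ∑ xs f ℚ.+ ∑ xs g
  ∑-+ []       f g = refl
  ∑-+ (x ∷ xs) f g = trans (cong (f x ℚ.+ g x ℚ.+_) (∑-+ xs f g))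
    (interchange (f x) (g x) (∑ xs f) (∑ xs g))
    where
    open +-*-Solver
    interchange : ∀ a b c d → (a ℚ.+ b) ℚ.+ (c ℚ.+ d) ≡ (a ℚ.+ c) ℚ.+ (b ℚ.+ d)
    interchange = solve 4 (λ a b c d → (a :+ b) :+ (c :+ d) := (a :+ c) :+ (b :+ d)) refl

∑-subsets : ∀ n g → ∑ (subsets (suc n)) g ≡ ∑ (subsets n) (λ S → g (true ∷ S) ℚ.+ g (false ∷ S))
∑-subsets n g = begin
  ∑ (List.map (true ∷_) Ss ++ List.map (false ∷_) Ss) g
    ≡⟨ ∑-++ (List.map (true ∷_) Ss) _ g ⟩
  ∑ (List.map (true ∷_) Ss) g ℚ.+ ∑ (List.map (false ∷_) Ss) g
    ≡⟨ cong₂ ℚ._+_ (∑-map (true ∷_) Ss g) (∑-map (false ∷_) Ss g) ⟩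
  ∑ Ss (g ∘ (true ∷_)) ℚ.+ ∑ Ss (g ∘ (false ∷_))
    ≡⟨ sym (∑-+ Ss (g ∘ (true ∷_)) (g ∘ (false ∷_))) ⟩
  ∑ Ss (λ S → g (true ∷ S) ℚ.+ g (false ∷ S)) ∎
  where
  open ≡-Reasoning
  Ss = subsets n

when : Bool → ℚ → ℚ
when b q = if b then q else 0ℚ

weightedSum : Graph n → Vec (ℚ × ℚ) n → ℚ
weightedSum {n} G w = ∑ (subsets n) λ S → when (does (independent? G S)) (weight w S)

module _ (v : Fin n) (G : Graph n) (S : Subset n) where

  independent-false : does (independent? (addPendant v G) (false ∷ S)) ≡ does (independent? G S)
  independent-false = does-⇔ (mk⇔ to from) (independent? (addPendant v G) (false ∷ S)) (independent? G S)
    where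
    to : Independent (addPendant v G) (false ∷ S) → Independent G S
    to ind i j i∈S j∈S a = ind (suc i) (suc j) (there i∈S) (there j∈S) (old a)
    from : Independent G S → Independent (addPendant v G) (false ∷ S)
    from ind (suc i) (suc j) (there i∈S) (there j∈S) (old a) = ind i j i∈S j∈S a

  independent-true : does (independent? (addPendant v G) (true ∷ S)) ≡
                     not (lookup S v) ∧ does (independent? G S)
  independent-true with lookup S v in eq
  ... | true  = dec-false (independent? (addPendant v G) (true ∷ S)) λ ind →
    ind zero (suc v) here (there (lookup⇒[]= v S eq)) leafˡ
  ... | false = does-⇔ (mk⇔ to from) (independent? (addPendant v G) (true ∷ S)) (independent? G S)
    where
    to : Independent (addPendant v G) (true ∷ S) → Independent G S
    to ind i j i∈S j∈S a = ind (suc i) (suc j) (there i∈S) (there j∈S) (old a)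
    v∉S : v ∉ S
    v∉S v∈S = contradiction (trans (sym eq) ([]=⇒lookup v∈S)) λ ()
    from : Independent G S → Independent (addPendant v G) (true ∷ S)
    from ind zero    (suc j) _ (there j∈S) leafˡ = v∉S j∈S
    from ind (suc i) zero (there i∈S) _ leafʳ = v∉S i∈S
    from ind (suc i) (suc j) (there i∈S) (there j∈S) (old a) = ind i j i∈S j∈S a

*-swap : ∀ x y z → x ℚ.* (y ℚ.* z) ≡ y ℚ.* (x ℚ.* z)
*-swap = solve 3 (λ x y z → x :* (y :* z) := y :* (x :* z)) refl
  where open +-*-Solver

weight-updateAt : ∀ (ws : Vec (ℚ × ℚ) n) v a₀ b₀ S → weight (updateAt ws v (merge (a₀ , b₀))) S ≡
  (if lookup S v then b₀ else a₀ ℚ.+ b₀) ℚ.* weight ws S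
weight-updateAt ((a , b) ∷ ws) zero    a₀ b₀ (true ∷ S)  = ℚ.*-assoc b₀ a _
weight-updateAt ((a , b) ∷ ws) zero    a₀ b₀ (false ∷ S) = ℚ.*-assoc (a₀ ℚ.+ b₀) b _
weight-updateAt ((a , b) ∷ ws) (suc v) a₀ b₀ (true ∷ S)  =
  trans (cong (a ℚ.*_) (weight-updateAt ws v a₀ b₀ S))
        (*-swap a (if lookup S v then b₀ else a₀ ℚ.+ b₀) (weight ws S))
weight-updateAt ((a , b) ∷ ws) (suc v) a₀ b₀ (false ∷ S) =
  trans (cong (b ℚ.*_) (weight-updateAt ws v a₀ b₀ S))
        (*-swap b (if lookup S v then b₀ else a₀ ℚ.+ b₀) (weight ws S))

-- Sum first over the two choices for the leaf. If its neighbour is chosen, the leaf is excluded and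
-- gives a factor `b₀`; otherwise it is free and gives `a₀ + b₀`. By these factors `merge` changes
-- the neighbour's weight.
weightedSum≡eliminate : ∀ (c : Code n) w → weightedSum (graph c) w ≡ eliminate c w
weightedSum≡eliminate single ((a , b) ∷ []) = single-sum a b
  where
  open +-*-Solver
  single-sum : ∀ a b → a ℚ.* 1ℚ ℚ.+ (b ℚ.* 1ℚ ℚ.+ 0ℚ) ≡ a ℚ.+ b
  single-sum = solve 2 (λ a b → a :* con 1ℚ :+ (b :* con 1ℚ :+ con 0ℚ) := a :+ b) refl
weightedSum≡eliminate {suc n} (pendant v c) ((a₀ , b₀) ∷ ws) = begin
  weightedSum (addPendant v G) ((a₀ , b₀) ∷ ws)
    ≡⟨ ∑-subsets n _ ⟩
  ∑ (subsets n) _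
    ≡⟨ ∑-cong (subsets n) termwise ⟩
  weightedSum G (updateAt ws v (merge (a₀ , b₀)))
    ≡⟨ weightedSum≡eliminate c _ ⟩
  eliminate c (updateAt ws v (merge (a₀ , b₀))) ∎
  where
  open ≡-Reasoning
  G = graph c
  combine : ∀ s i x →
    when (not s ∧ i) (a₀ ℚ.* x) ℚ.+ when i (b₀ ℚ.* x) ≡
    when i ((if s then b₀ else a₀ ℚ.+ b₀) ℚ.* x)
  combine true  true  x = ℚ.+-identityˡ _
  combine true  false x = refl
  combine false true  x = sym (ℚ.*-distribʳ-+ x a₀ b₀)
  combine false false x = refl
  termwise : ∀ S →
    when (does (independent? (addPendant v G) (true ∷ S))) (a₀ ℚ.* weight ws S) ℚ.+
    when (does (independent? (addPendant v G) (false ∷ S))) (b₀ ℚ.* weight ws S) ≡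
    when (does (independent? G S)) (weight (updateAt ws v (merge (a₀ , b₀))) S)
  termwise S
    rewrite independent-true v G S | independent-false v G S | weight-updateAt ws v a₀ b₀ S
    = combine (lookup S v) (does (independent? G S)) (weight ws S)

-- Evaluating I at a real

valueAt : Graph n → ℚ → ℚ
valueAt {n} G q = sum {suc n} λ k → indepCount G (toℕ k) · q ^ℚ toℕ k

seq-sum : ∀ {m} (t : Fin m → ℝ) j → seq (D.sum t) j ≡ sum (λ k → seq (t k) j)
seq-sum {zero}  t j = refl
seq-sum {suc m} t j = cong (seq (t zero) j ℚ.+_) (seq-sum (t ∘ suc) j)

seq-· : ∀ m x j → seq (m D.· x) j ≡ m · seq x j
seq-· zero    x j = refl
seq-· (suc m) x j = cong (seq x j ℚ.+_) (seq-· m x j)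

seq-^ : ∀ x m j → seq (x D.^ m) j ≡ seq x j ^ℚ m
seq-^ x zero    j = refl
seq-^ x (suc m) j = cong (seq x j ℚ.*_) (seq-^ x m j)

-- Real operations act termwise on Cauchy sequences, so the polynomial can be studied over the
-- rationals.
seq-I : ∀ (G : Graph n) x j → seq (I G x) j ≡ valueAt G (seq x j)
seq-I {n} G x j = trans (seq-sum {suc n} (λ k → indepCount G (toℕ k) D.· x D.^ toℕ k) j)
  (sum-cong-≗ {suc n} λ k → trans (seq-· (indepCount G (toℕ k)) (x D.^ toℕ k) j)
                          (cong (indepCount G (toℕ k) ·_) (seq-^ x (toℕ k) j)))

sum-when : ∀ {m} j (f : ℕ → ℚ) → j ℕ.< m →
  sum {m} (λ k → when (j ℕ.≡ᵇ toℕ k) (f (toℕ k))) ≡ f j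
sum-when {suc m} zero    f _           = trans (cong (f 0 ℚ.+_) (sum-replicate-zero m)) (ℚ.+-identityʳ (f 0))
sum-when {suc m} (suc j) f (ℕ.s≤s j<m) = trans (ℚ.+-identityˡ _) (sum-when j (f ∘ suc) j<m)

module _ {A : Set} {P : Pred A 0ℓ} (P? : Decidable P) (size : A → ℕ) (size≤n : ∀ x → size x ℕ.≤ n) (q : ℚ) where

  private
    count : List A → ℕ → ℕ
    count xs k = length (filter (λ x → (size x ℕ.≟ k) ×-dec P? x) xs)

    count-∷ : ∀ x xs k y → count (x ∷ xs) k · y ≡
      when (does (P? x)) (when (size x ℕ.≡ᵇ k) y) ℚ.+ count xs k · y
    -- `does (size x ℕ.≟ k)` computes to `size x ℕ.≡ᵇ k`, so these two booleans decide the filter.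
    count-∷ x xs k y with size x ℕ.≡ᵇ k | does (P? x)
    ... | true  | true  = refl
    ... | true  | false = sym (ℚ.+-identityˡ _)
    ... | false | true  = sym (ℚ.+-identityˡ _)
    ... | false | false = sym (ℚ.+-identityˡ _)

    sum-when-when : ∀ b x → sum {suc n} (λ k → when b (when (size x ℕ.≡ᵇ toℕ k) (q ^ℚ toℕ k))) ≡
      when b (q ^ℚ size x)
    sum-when-when true  x = sum-when (size x) (q ^ℚ_) (ℕ.s≤s (size≤n x))
    sum-when-when false x = sum-replicate-zero (suc n)

  -- Double counting: each `x` contributes only to the coefficient of degree `size x`, and `size≤n`
  -- places that degree among the `suc n` summed ones.
  sum-count : ∀ xs → sum {suc n} (λ k → count xs (toℕ k) · q ^ℚ toℕ k) ≡
    ∑ xs (λ x → when (does (P? x)) (q ^ℚ size x))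
  sum-count []       = sum-replicate-zero (suc n)
  sum-count (x ∷ xs) = begin
    sum {suc n} (λ k → count (x ∷ xs) (toℕ k) · q ^ℚ toℕ k)
      ≡⟨ sum-cong-≗ {suc n} (λ k → count-∷ x xs (toℕ k) (q ^ℚ toℕ k)) ⟩
    sum {suc n} (λ k → when (does (P? x)) (when (size x ℕ.≡ᵇ toℕ k) (q ^ℚ toℕ k)) ℚ.+ count xs (toℕ k) · q ^ℚ toℕ k)
      ≡⟨ ∑-distrib-+ {suc n} (λ k → when (does (P? x)) (when (size x ℕ.≡ᵇ toℕ k) (q ^ℚ toℕ k)))
                             (λ k → count xs (toℕ k) · q ^ℚ toℕ k) ⟩
    sum {suc n} (λ k → when (does (P? x)) (when (size x ℕ.≡ᵇ toℕ k) (q ^ℚ toℕ k))) ℚ.+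
    sum {suc n} (λ k → count xs (toℕ k) · q ^ℚ toℕ k)
      ≡⟨ cong₂ ℚ._+_ (sum-when-when (does (P? x)) x) (sum-count xs) ⟩
    when (does (P? x)) (q ^ℚ size x) ℚ.+ ∑ xs (λ x → when (does (P? x)) (q ^ℚ size x)) ∎
    where open ≡-Reasoning

weight-replicate : ∀ q (S : Subset n) → weight (replicate n (q , 1ℚ)) S ≡ q ^ℚ ∣ S ∣
weight-replicate q []          = refl
weight-replicate q (true ∷ S)  = cong (q ℚ.*_) (weight-replicate q S)
weight-replicate q (false ∷ S) = trans (ℚ.*-identityˡ _) (weight-replicate q S)

valueAt≡eliminate : ∀ (c : Code n) q → valueAt (graph c) q ≡ eliminateConst c (q , 1ℚ)
valueAt≡eliminate {n} c q = begin
  valueAt (graph c) q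
    ≡⟨ sum-count (independent? (graph c)) ∣_∣ ∣p∣≤n q (subsets n) ⟩
  ∑ (subsets n) (λ S → when (does (independent? (graph c) S)) (q ^ℚ ∣ S ∣))
    ≡⟨ ∑-cong (subsets n) (λ S → cong (when _) (sym (weight-replicate q S))) ⟩
  weightedSum (graph c) (replicate n (q , 1ℚ))
    ≡⟨ weightedSum≡eliminate c _ ⟩
  eliminateConst c (q , 1ℚ) ∎
  where open ≡-Reasoning

-- Bisection

<⇒0<- : ∀ {p q} → p ℚ.< q → 0ℚ ℚ.< q ℚ.- p
<⇒0<- {p} {q} p<q = subst (ℚ._< q ℚ.- p) (ℚ.+-inverseʳ p) (ℚ.+-monoˡ-< (ℚ.- p) p<q)

≤⇒0≤- : ∀ {p q} → p ℚ.≤ q → 0ℚ ℚ.≤ q ℚ.- p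
≤⇒0≤- {p} {q} p≤q = subst (ℚ._≤ q ℚ.- p) (ℚ.+-inverseʳ p) (ℚ.+-monoˡ-≤ (ℚ.- p) p≤q)

*-mono-< : ∀ {r p q} → 0ℚ ℚ.< r → p ℚ.< q → r ℚ.* p ℚ.< r ℚ.* q
*-mono-< {r} 0<r = ℚ.*-monoʳ-<-pos r {{ℚ.positive 0<r}}

*-mono-≤ : ∀ {r p q} → 0ℚ ℚ.≤ r → p ℚ.≤ q → r ℚ.* p ℚ.≤ r ℚ.* q
*-mono-≤ {r} 0≤r = ℚ.*-monoˡ-≤-nonNeg r {{ℚ.nonNegative 0≤r}}

*-cancel-< : ∀ {r p q} → 0ℚ ℚ.< r → r ℚ.* p ℚ.< r ℚ.* q → p ℚ.< q
*-cancel-< {r} 0<r = ℚ.*-cancelˡ-<-nonNeg r {{ℚ.nonNegative (ℚ.<⇒≤ 0<r)}}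

0<* : ∀ {p q} → 0ℚ ℚ.< p → 0ℚ ℚ.< q → 0ℚ ℚ.< p ℚ.* q
0<* {p} {q} 0<p 0<q = subst (ℚ._< p ℚ.* q) (ℚ.*-zeroʳ p) (*-mono-< 0<p 0<q)

0≤* : ∀ {p q} → 0ℚ ℚ.≤ p → 0ℚ ℚ.≤ q → 0ℚ ℚ.≤ p ℚ.* q
0≤* {p} {q} 0≤p 0≤q = subst (ℚ._≤ p ℚ.* q) (ℚ.*-zeroʳ p) (*-mono-≤ 0≤p 0≤q)

p≤∣p∣ : ∀ p → p ℚ.≤ ℚ.∣ p ∣
p≤∣p∣ p with ℚ.≤-total 0ℚ p
... | inj₁ 0≤p = ℚ.≤-reflexive (sym (ℚ.0≤p⇒∣p∣≡p 0≤p))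
... | inj₂ p≤0 = ℚ.≤-trans p≤0 (ℚ.0≤∣p∣ p)

-[x-y]≡y-x : ∀ x y → ℚ.- (x ℚ.- y) ≡ y ℚ.- x
-[x-y]≡y-x = solve 2 (λ x y → :- (x :- y) := y :- x) refl
  where open +-*-Solver

x+[y-x]≡y : ∀ x y → x ℚ.+ (y ℚ.- x) ≡ y
x+[y-x]≡y = solve 2 (λ x y → x :+ (y :- x) := y) refl
  where open +-*-Solver

∣-∣-≤-width : ∀ {l h x y} → l ℚ.≤ x → x ℚ.≤ h → l ℚ.≤ y → y ℚ.≤ h → ℚ.∣ x ℚ.- y ∣ ℚ.≤ h ℚ.- l
∣-∣-≤-width {l} {h} {x} {y} l≤x x≤h l≤y y≤h with ℚ.∣p∣≡p∨∣p∣≡-p (x ℚ.- y)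
... | inj₁ eq = subst (ℚ._≤ h ℚ.- l) (sym eq) (ℚ.+-mono-≤ x≤h (ℚ.neg-antimono-≤ l≤y))
... | inj₂ eq = subst (ℚ._≤ h ℚ.- l) (sym (trans eq (-[x-y]≡y-x x y))) (ℚ.+-mono-≤ y≤h (ℚ.neg-antimono-≤ l≤x))

-- Zero lies between `x` and `y`. This turns closeness of two values of opposite sign into smallness
-- of `x`.
∣-∣-opposite : ∀ {x y} → (x ℚ.≤ 0ℚ × 0ℚ ℚ.≤ y) ⊎ (y ℚ.≤ 0ℚ × 0ℚ ℚ.≤ x) →
  ℚ.∣ x ℚ.- 0ℚ ∣ ℚ.≤ ℚ.∣ x ℚ.- y ∣
∣-∣-opposite {x} {y} (inj₁ (x≤0 , 0≤y)) = begin
  ℚ.∣ x ℚ.- 0ℚ ∣ ≤⟨ ∣-∣-≤-width ℚ.≤-refl (ℚ.≤-trans x≤0 0≤y) x≤0 0≤y ⟩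
  y ℚ.- x        ≤⟨ p≤∣p∣ _ ⟩
  ℚ.∣ y ℚ.- x ∣  ≡⟨ cong ℚ.∣_∣ (sym (-[x-y]≡y-x x y)) ⟩
  ℚ.∣ ℚ.- (x ℚ.- y) ∣ ≡⟨ ℚ.∣-p∣≡∣p∣ (x ℚ.- y) ⟩
  ℚ.∣ x ℚ.- y ∣ ∎
  where open ℚ.≤-Reasoning
∣-∣-opposite {x} {y} (inj₂ (y≤0 , 0≤x)) = begin
  ℚ.∣ x ℚ.- 0ℚ ∣ ≤⟨ ∣-∣-≤-width (ℚ.≤-trans y≤0 0≤x) ℚ.≤-refl y≤0 0≤x ⟩
  x ℚ.- y        ≤⟨ p≤∣p∣ _ ⟩
  ℚ.∣ x ℚ.- y ∣ ∎
  where open ℚ.≤-Reasoning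

ℕ→ℚ : ℕ → ℚ
ℕ→ℚ zero    = 0ℚ
ℕ→ℚ (suc m) = 1ℚ ℚ.+ ℕ→ℚ m

toℚᵘ-ℕ→ℚ : ∀ m → toℚᵘ (ℕ→ℚ m) ℚᵘ.≃ mkℚᵘ (+ m) 0
toℚᵘ-ℕ→ℚ zero    = ℚᵘ.≃-refl
toℚᵘ-ℕ→ℚ (suc m) = begin-equality
  toℚᵘ (1ℚ ℚ.+ ℕ→ℚ m)           ≃⟨ ℚ.toℚᵘ-homo-+ 1ℚ (ℕ→ℚ m) ⟩
  ℚᵘ.1ℚᵘ ℚᵘ.+ toℚᵘ (ℕ→ℚ m)      ≃⟨ ℚᵘ.+-congʳ ℚᵘ.1ℚᵘ (toℚᵘ-ℕ→ℚ m) ⟩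
  ℚᵘ.1ℚᵘ ℚᵘ.+ mkℚᵘ (+ m) 0        ≃⟨ *≡* (cong (λ i → (+ 1 ℤ.+ i) ℤ.* + 1) (ℤ.*-identityʳ (+ m))) ⟩
  mkℚᵘ (+ suc m) 0                ∎
  where open ℚᵘ.≤-Reasoning

archimedean : ∀ q → ∃[ m ] q ℚ.< ℕ→ℚ m
archimedean q@(mkℚ i d-1 _) = suc ℤ.∣ i ∣ , ℚ.toℚᵘ-cancel-< (begin-strict
  toℚᵘ q                        <⟨ ℚᵘ.*<* lemma ⟩
  mkℚᵘ (+ suc ℤ.∣ i ∣) 0        ≃⟨ ℚᵘ.≃-sym (toℚᵘ-ℕ→ℚ (suc ℤ.∣ i ∣)) ⟩
  toℚᵘ (ℕ→ℚ (suc ℤ.∣ i ∣))    ∎)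
  where
  i≤∣i∣ : ∀ i → i ℤ.≤ + ℤ.∣ i ∣
  i≤∣i∣ (+ n)    = ℤ.≤-refl
  i≤∣i∣ -[1+ n ] = ℤ.-≤+
  lemma : i ℤ.* + 1 ℤ.< + suc ℤ.∣ i ∣ ℤ.* + suc d-1
  lemma = ℤ.≤-<-trans (subst (ℤ._≤ + ℤ.∣ i ∣) (sym (ℤ.*-identityʳ i)) (i≤∣i∣ i))
    (ℤ.+<+ (ℕ.m≤m*n (suc ℤ.∣ i ∣) (suc d-1)))
  open ℚᵘ.≤-Reasoning

archimedean-* : ∀ q {ε} → 0ℚ ℚ.< ε → ∃[ m ] q ℚ.< ℕ→ℚ m ℚ.* ε
archimedean-* q {ε} 0<ε with archimedean (q ℚ.* 1/ε)
  where
  instance _ = ℚ.pos⇒nonZero ε {{ℚ.positive 0<ε}}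
  1/ε = ℚ.1/ ε
... | m , q/ε<m = m , subst (ℚ._< ℕ→ℚ m ℚ.* ε) cancel (ℚ.*-monoˡ-<-pos ε {{ℚ.positive 0<ε}} q/ε<m)
  where
  instance _ = ℚ.pos⇒nonZero ε {{ℚ.positive 0<ε}}
  cancel : q ℚ.* ℚ.1/ ε ℚ.* ε ≡ q
  cancel = trans (ℚ.*-assoc q _ ε) (trans (cong (q ℚ.*_) (ℚ.*-inverseˡ ε)) (ℚ.*-identityʳ q))

private
  half : ∀ l h → ½ ℚ.* (l ℚ.+ h) ℚ.- l ≡ ½ ℚ.* (h ℚ.- l)
  half = solve 2 (λ l h → con ½ :* (l :+ h) :- l := con ½ :* (h :- l)) refl
    where open +-*-Solver

  half′ : ∀ l h → h ℚ.- ½ ℚ.* (l ℚ.+ h) ≡ ½ ℚ.* (h ℚ.- l)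
  half′ = solve 2 (λ l h → h :- con ½ :* (l :+ h) := con ½ :* (h :- l)) refl
    where open +-*-Solver

0≤-⇒≤ : ∀ {p q} → 0ℚ ℚ.≤ q ℚ.- p → p ℚ.≤ q
0≤-⇒≤ {p} {q} 0≤q-p = subst₂ ℚ._≤_ (ℚ.+-identityʳ p) (x+[y-x]≡y p q) (ℚ.+-monoʳ-≤ p 0≤q-p)

-- Bisection stays among rational points, where the sign of `f` is decidable; a real arises only as
-- the limit.
module Bisection (f : ℚ → ℚ) where

  Bracket : ℚ × ℚ → Set
  Bracket (l , h) = l ℚ.≤ h × f l ℚ.≤ 0ℚ × 0ℚ ℚ.≤ f h

  width : ℚ × ℚ → ℚ
  width (l , h) = h ℚ.- l

  bisect : ℚ × ℚ → ℚ × ℚ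
  bisect (l , h) with f (½ ℚ.* (l ℚ.+ h)) ℚ.≤? 0ℚ
  ... | yes _ = ½ ℚ.* (l ℚ.+ h) , h
  ... | no  _ = l , ½ ℚ.* (l ℚ.+ h)

  -- The endpoints of all successive brackets in one sequence, so that a limit
  -- of f along it is squeezed between values ≤ 0 and values ≥ 0.
  endpoints : ℚ × ℚ → ℕ → ℚ
  endpoints (l , h) zero          = l
  endpoints (l , h) (suc zero)    = h
  endpoints s       (suc (suc j)) = endpoints (bisect s) j

  bisections : ℕ → ℚ × ℚ → ℚ × ℚ
  bisections zero    s = s
  bisections (suc m) s = bisections m (bisect s)

  module _ {l h : ℚ} (l≤h : l ℚ.≤ h) where
    private
      mid = ½ ℚ.* (l ℚ.+ h)
      0≤half : 0ℚ ℚ.≤ ½ ℚ.* (h ℚ.- l)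
      0≤half = 0≤* (ℚ.nonNegative⁻¹ ½) (≤⇒0≤- l≤h)

    l≤mid : l ℚ.≤ mid
    l≤mid = 0≤-⇒≤ (subst (0ℚ ℚ.≤_) (sym (half l h)) 0≤half)

    mid≤h : mid ℚ.≤ h
    mid≤h = 0≤-⇒≤ (subst (0ℚ ℚ.≤_) (sym (half′ l h)) 0≤half)

  width-bisect : ∀ s → width (bisect s) ≡ ½ ℚ.* width s
  width-bisect (l , h) with f (½ ℚ.* (l ℚ.+ h)) ℚ.≤? 0ℚ
  ... | yes _ = half′ l h
  ... | no  _ = half l h

  bracket-bisect : ∀ s → Bracket s →
    Bracket (bisect s) × proj₁ s ℚ.≤ proj₁ (bisect s) × proj₂ (bisect s) ℚ.≤ proj₂ s
  bracket-bisect (l , h) (l≤h , fl≤0 , 0≤fh) with f (½ ℚ.* (l ℚ.+ h)) ℚ.≤? 0ℚ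
  ... | yes fm≤0 = (mid≤h l≤h , fm≤0 , 0≤fh) , l≤mid l≤h , ℚ.≤-refl
  ... | no  fm≰0 = (l≤mid l≤h , fl≤0 , ℚ.<⇒≤ (ℚ.≰⇒> fm≰0)) , ℚ.≤-refl , mid≤h l≤h

  bracket-bisections : ∀ m s → Bracket s →
    Bracket (bisections m s) × proj₁ s ℚ.≤ proj₁ (bisections m s)
  bracket-bisections zero    s br = br , ℚ.≤-refl
  bracket-bisections (suc m) s br =
    let br′ , l≤l′ , _ = bracket-bisect s br
        br″ , l′≤l″   = bracket-bisections m (bisect s) br′
    in br″ , ℚ.≤-trans l≤l′ l′≤l″

  endpoints-within : ∀ j s → Bracket s → proj₁ s ℚ.≤ endpoints s j × endpoints s j ℚ.≤ proj₂ s
  endpoints-within zero          s (l≤h , _) = ℚ.≤-refl , l≤h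
  endpoints-within (suc zero)    s (l≤h , _) = l≤h , ℚ.≤-refl
  endpoints-within (suc (suc j)) s br =
    let br′ , l≤l′ , h′≤h = bracket-bisect s br
        l′≤z , z≤h′       = endpoints-within j (bisect s) br′
    in ℚ.≤-trans l≤l′ l′≤z , ℚ.≤-trans z≤h′ h′≤h

  -- Each bracket fills two positions of the sequence, hence the index `m * 2`.
  endpoints-eventually : ∀ m s j → Bracket s → m ℕ.* 2 ℕ.≤ j →
    proj₁ (bisections m s) ℚ.≤ endpoints s j × endpoints s j ℚ.≤ proj₂ (bisections m s)
  endpoints-eventually zero    s j             br _                     = endpoints-within j s br
  endpoints-eventually (suc m) s (suc (suc j)) br (ℕ.s≤s (ℕ.s≤s 2m≤j)) =
    endpoints-eventually m (bisect s) j (proj₁ (bracket-bisect s br)) 2m≤j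

  endpoints-opposite : ∀ j s → Bracket s →
    (f (endpoints s j) ℚ.≤ 0ℚ × 0ℚ ℚ.≤ f (endpoints s (suc j))) ⊎
    (f (endpoints s (suc j)) ℚ.≤ 0ℚ × 0ℚ ℚ.≤ f (endpoints s j))
  endpoints-opposite zero          s (_ , signs)     = inj₁ signs
  -- Between brackets, the old right endpoint is followed by the new left one, again with values on
  -- opposite sides of zero.
  endpoints-opposite (suc zero)    s br@(_ , _ , 0≤fh) =
    inj₂ (proj₁ (proj₂ (proj₁ (bracket-bisect s br))) , 0≤fh)
  endpoints-opposite (suc (suc j)) s br              =
    endpoints-opposite j (bisect s) (proj₁ (bracket-bisect s br))

  -- One halving per step would give a factor `2 ^ m`; the weaker linear bound is what the
  -- Archimedean argument uses.
  width-bisections : ∀ m s → Bracket s → ℕ→ℚ m ℚ.* width (bisections m s) ℚ.≤ width s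
  width-bisections zero    s (l≤h , _) = subst (ℚ._≤ width s) (sym (ℚ.*-zeroˡ (width s))) (≤⇒0≤- l≤h)
  width-bisections (suc m) s br = begin
    (1ℚ ℚ.+ ℕ→ℚ m) ℚ.* w
      ≡⟨ trans (ℚ.*-distribʳ-+ w 1ℚ (ℕ→ℚ m)) (cong (ℚ._+ ℕ→ℚ m ℚ.* w) (ℚ.*-identityˡ w)) ⟩
    w ℚ.+ ℕ→ℚ m ℚ.* w
      ≤⟨ ℚ.+-mono-≤ (shrink m (bisect s) br′) (width-bisections m (bisect s) br′) ⟩
    width (bisect s) ℚ.+ width (bisect s)
      ≡⟨ cong₂ ℚ._+_ (width-bisect s) (width-bisect s) ⟩
    ½ ℚ.* width s ℚ.+ ½ ℚ.* width s
      ≡⟨ trans (sym (ℚ.*-distribʳ-+ (width s) ½ ½)) (ℚ.*-identityˡ (width s)) ⟩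
    width s ∎
    where
    open ℚ.≤-Reasoning
    w = width (bisections m (bisect s))
    br′ = proj₁ (bracket-bisect s br)
    shrink : ∀ m s → Bracket s → width (bisections m s) ℚ.≤ width s
    shrink zero    s br = ℚ.≤-refl
    shrink (suc m) s br =
      let br′ , l≤l′ , h′≤h = bracket-bisect s br
      in ℚ.≤-trans (shrink m (bisect s) br′) (ℚ.+-mono-≤ h′≤h (ℚ.neg-antimono-≤ l≤l′))

  narrow : ∀ s → Bracket s → ∀ {ε} → 0ℚ ℚ.< ε → ∃[ m ] width (bisections m s) ℚ.< ε
  narrow s br {ε} 0<ε with archimedean-* (width s) 0<ε
  ... | m , w<mε = m , ℚ.≰⇒> λ ε≤w → ℚ.<-irrefl refl (begin-strict
    width s                          <⟨ w<mε ⟩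
    ℕ→ℚ m ℚ.* ε                    ≤⟨ *-mono-≤ (0≤ℕ→ℚ m) ε≤w ⟩
    ℕ→ℚ m ℚ.* width (bisections m s) ≤⟨ width-bisections m s br ⟩
    width s                          ∎)
    where
    open ℚ.≤-Reasoning
    0≤ℕ→ℚ : ∀ m → 0ℚ ℚ.≤ ℕ→ℚ m
    0≤ℕ→ℚ zero    = ℚ.≤-refl
    0≤ℕ→ℚ (suc m) = ℚ.≤-trans (0≤ℕ→ℚ m) (subst (ℚ._≤ 1ℚ ℚ.+ ℕ→ℚ m) (ℚ.+-identityˡ (ℕ→ℚ m))
                        (ℚ.+-monoˡ-≤ (ℕ→ℚ m) (ℚ.nonNegative⁻¹ 1ℚ)))

  endpoints-cauchy : ∀ s → Bracket s → IsCauchy (endpoints s)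
  endpoints-cauchy s br ε 0<ε with narrow s br 0<ε
  ... | m , w<ε = m ℕ.* 2 , λ i j 2m≤i 2m≤j →
    let l≤x , x≤h = endpoints-eventually m s i br 2m≤i
        l≤y , y≤h = endpoints-eventually m s j br 2m≤j
    in ℚ.≤-<-trans (∣-∣-≤-width l≤x x≤h l≤y y≤h) w<ε

-- Construction of largest real roots

Represents : (ℚ → ℚ) → (ℝ → ℝ) → Set
Represents f F = ∀ x j → seq (F x) j ≡ f (seq x j)

-- Increase is demanded only where `f` is nonnegative. From the right end of any bracket on, `f`
-- then stays nonnegative and increases, so no root lies to the right of it.
largestRoot : ∀ {F f l h} → Represents f F →
  l ℚ.≤ h → f l ℚ.≤ 0ℚ → 0ℚ ℚ.≤ f h →
  (∀ {p q} → l ℚ.≤ p → 0ℚ ℚ.≤ f p → p ℚ.< q → f p ℚ.< f q) →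
  ∃[ ξ ] ((F ξ D.≈ D.0ℝ × (∀ s → F s D.≈ D.0ℝ → s D.≤ ξ)) × ξ D.≤ fromℚ h)
largestRoot {F} {f} {l} {h} rep l≤h fl≤0 0≤fh increasing = ξ , (root , largest) , below
  where
  open Bisection f
  br : Bracket (l , h)
  br = l≤h , fl≤0 , 0≤fh
  z = endpoints (l , h)
  ξ = mkℝ z (endpoints-cauchy (l , h) br)

  root : F ξ D.≈ D.0ℝ
  -- The Cauchy property of `F ξ` itself replaces a continuity argument: consecutive terms are close
  -- and lie on opposite sides of zero, hence are small.
  root ε 0<ε with cauchy (F ξ) ε 0<ε
  ... | N , close = N , λ j N≤j →
    subst (λ y → ℚ.∣ y ℚ.- 0ℚ ∣ ℚ.< ε) (sym (rep ξ j))
      (ℚ.≤-<-trans (∣-∣-opposite (endpoints-opposite j (l , h) br))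
        (subst₂ (λ x y → ℚ.∣ x ℚ.- y ∣ ℚ.< ε) (rep ξ j) (rep ξ (suc j))
          (close j (suc j) N≤j (ℕ.m≤n⇒m≤1+n N≤j))))

  largest : ∀ s → F s D.≈ D.0ℝ → s D.≤ ξ
  largest s Fs≈0 ε 0<ε with narrow (l , h) br 0<ε
  ... | m , w<ε = N ℕ.⊔ m ℕ.* 2 , λ j N⊔2m≤j → ℚ.≮⇒≥ λ z+ε<s →
    let p<s = ℚ.≤-<-trans (ℚ.+-monoˡ-≤ ε
                (proj₁ (endpoints-eventually m (l , h) j br (ℕ.m⊔n≤o⇒n≤o N (m ℕ.* 2) N⊔2m≤j)))) z+ε<s
    in ℚ.<-irrefl refl (begin-strict
      f p                      <⟨ increasing (ℚ.≤-trans l≤hₘ (ℚ.<⇒≤ hₘ<p)) (ℚ.<⇒≤ 0<fp) p<s ⟩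
      f (seq s j)              ≤⟨ p≤∣p∣ _ ⟩
      ℚ.∣ f (seq s j) ∣        ≡⟨ cong ℚ.∣_∣ (trans (sym (rep s j)) (sym (ℚ.+-identityʳ _))) ⟩
      ℚ.∣ seq (F s) j ℚ.- 0ℚ ∣ <⟨ close j (ℕ.m⊔n≤o⇒m≤o N (m ℕ.* 2) N⊔2m≤j) ⟩
      f p                      ∎)
    where
    open ℚ.≤-Reasoning
    lₘ = proj₁ (bisections m (l , h))
    hₘ = proj₂ (bisections m (l , h))
    brₘ : Bracket (lₘ , hₘ)
    brₘ = proj₁ (bracket-bisections m (l , h) br)
    l≤hₘ : l ℚ.≤ hₘ
    l≤hₘ = ℚ.≤-trans (proj₂ (bracket-bisections m (l , h) br)) (proj₁ brₘ)
    -- The width is below `ε`, so this point lies to the right of the bracket and `f p` is positive.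
    -- It serves as the tolerance in `Fs≈0`: a term of `s` beyond `p` would have a value above
    -- `f p`.
    p = lₘ ℚ.+ ε
    hₘ<p : hₘ ℚ.< p
    hₘ<p = subst (ℚ._< p) (x+[y-x]≡y lₘ hₘ) (ℚ.+-monoʳ-< lₘ w<ε)
    0<fp : 0ℚ ℚ.< f p
    0<fp = ℚ.≤-<-trans (proj₂ (proj₂ brₘ)) (increasing l≤hₘ (proj₂ (proj₂ brₘ)) hₘ<p)
    N = proj₁ (Fs≈0 (f p) 0<fp)
    close = proj₂ (Fs≈0 (f p) 0<fp)

  below : ξ D.≤ fromℚ h
  below ε 0<ε = 0 , λ j _ → ℚ.≤-trans (proj₂ (endpoints-within j (l , h) br))
    (subst (ℚ._≤ h ℚ.+ ε) (ℚ.+-identityʳ h) (ℚ.+-monoʳ-≤ h (ℚ.<⇒≤ 0<ε)))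

fromℚ-mono-≤ : ∀ {p q} → p ℚ.≤ q → fromℚ p D.≤ fromℚ q
fromℚ-mono-≤ {p} {q} p≤q ε 0<ε =
  0 , λ _ _ → ℚ.≤-trans p≤q (subst (ℚ._≤ q ℚ.+ ε) (ℚ.+-identityʳ q) (ℚ.+-monoʳ-≤ q (ℚ.<⇒≤ 0<ε)))

≤-fromℚ-trans : ∀ {x p q} → x D.≤ fromℚ p → p ℚ.≤ q → x D.≤ fromℚ q
≤-fromℚ-trans x≤p p≤q ε 0<ε with x≤p ε 0<ε
... | N , x≤ = N , λ j N≤j → ℚ.≤-trans (x≤ j N≤j) (ℚ.+-monoˡ-≤ ε p≤q)

<⇒≰ : ∀ {F H f g} → Represents f F → Represents g H → ∀ {q} → g q ℚ.< f q →
  ¬ F (fromℚ q) D.≤ H (fromℚ q)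
<⇒≰ {f = f} {g} repF repH {q} gq<fq Fq≤Hq =
  let r , gq<r , r<fq = ℚ.<-dense gq<fq
      -- This slack turns the assumed inequality into `f q ≤ r`, against the choice of `r`.
      N , le = Fq≤Hq (r ℚ.- g q) (<⇒0<- gq<r)
  in ℚ.<-irrefl refl (ℚ.<-≤-trans r<fq
       (subst₂ ℚ._≤_ (repF (fromℚ q) N)
         (trans (cong (ℚ._+ (r ℚ.- g q)) (repH (fromℚ q) N)) (x+[y-x]≡y (g q) r))
         (le N ℕ.≤-refl)))

-- Attaching a leaf to every vertex

-- In the corona, vertex v has index attached v and its new leaf the index just before it.
attached : Fin n → Fin (n ℕ.* 2)
attached zero    = suc zero
attached (suc v) = suc (suc (attached v))

corona : Code n → Code (n ℕ.* 2)
corona single        = pendant zero single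
corona (pendant v c) = pendant zero (pendant (attached v) (corona c))

mergePairs : Vec (ℚ × ℚ) (n ℕ.* 2) → Vec (ℚ × ℚ) n
mergePairs {zero}  []           = []
mergePairs {suc n} (w ∷ w′ ∷ ws) = merge w w′ ∷ mergePairs ws

-- Each `merge` multiplies the two components of a weight by fixed factors, so merges into the same
-- vertex commute.
mergePairs-updateAt : ∀ (v : Fin n) w ws →
  mergePairs (updateAt ws (attached v) (merge w)) ≡ updateAt (mergePairs ws) v (merge w)
mergePairs-updateAt zero    (a₀ , b₀) ((a₁ , b₁) ∷ (a , b) ∷ ws) =
  cong (_∷ mergePairs ws) (cong₂ _,_ (*-swap b₁ b₀ a) (*-swap (a₁ ℚ.+ b₁) (a₀ ℚ.+ b₀) b))
mergePairs-updateAt (suc v) w         (w₁ ∷ w₂ ∷ ws) =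
  cong (merge w₁ w₂ ∷_) (mergePairs-updateAt v w ws)

-- Since merges commute, all the new leaves can be absorbed first, which leaves the old tree with
-- changed weights.
eliminate-corona : ∀ (c : Code n) ws → eliminate (corona c) ws ≡ eliminate c (mergePairs ws)
eliminate-corona single        (w ∷ w′ ∷ []) = refl
eliminate-corona (pendant v c) (w ∷ w′ ∷ ws) = trans
  (eliminate-corona c (updateAt ws (attached v) (merge (merge w w′))))
  (cong (eliminate c) (mergePairs-updateAt v (merge w w′) ws))

mergePairs-replicate : ∀ n p → mergePairs (replicate (n ℕ.* 2) p) ≡ replicate n (merge p p)
mergePairs-replicate zero    p = refl
mergePairs-replicate (suc n) p = cong (merge p p ∷_) (mergePairs-replicate n p)

coronas : ∀ k → Code 8 → Code (2 ^ (k + 3))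
coronas zero    c = c
coronas (suc k) c = subst Code (ℕ.*-comm (2 ^ (k + 3)) 2) (corona (coronas k c))

-- If `p = (a , b)` has slope `x = a / b`, then `merge p p` has slope `x / (1 + x)`, so this
-- iterates the corona substitution without division.
descend : ℕ → ℚ × ℚ → ℚ × ℚ
descend zero    p = p
descend (suc k) p = descend k (merge p p)

eliminateConst-subst : ∀ {m} (eq : m ≡ n) (c : Code m) p →
  eliminateConst (subst Code eq c) p ≡ eliminateConst c p
eliminateConst-subst refl c p = refl

eliminate-coronas : ∀ k c p → eliminateConst (coronas k c) p ≡ eliminateConst c (descend k p)
eliminate-coronas zero    c p = refl
eliminate-coronas (suc k) c p = begin
  eliminateConst (coronas (suc k) c) p
    ≡⟨ eliminateConst-subst (ℕ.*-comm m 2) (corona (coronas k c)) p ⟩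
  eliminateConst (corona (coronas k c)) p
    ≡⟨ eliminate-corona (coronas k c) (replicate (m ℕ.* 2) p) ⟩
  eliminate (coronas k c) (mergePairs (replicate (m ℕ.* 2) p))
    ≡⟨ cong (eliminate (coronas k c)) (mergePairs-replicate m p) ⟩
  eliminateConst (coronas k c) (merge p p)
    ≡⟨ eliminate-coronas k c (merge p p) ⟩
  eliminateConst c (descend k (merge p p)) ∎
  where
  open ≡-Reasoning
  m = 2 ^ (k + 3)

-- Slopes under the corona substitution

-- A nonnegative value of a homogeneous form that increases with the slope a / b cannot
-- decrease when b grows too, hence the condition b ≤ b′ next to the comparison of slopes.
_⊏_ : ℚ × ℚ → ℚ × ℚ → Set
(a , b) ⊏ (a′ , b′) = 0ℚ ℚ.< b × b ℚ.≤ b′ × a ℚ.* b′ ℚ.< a′ ℚ.* b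

-- For positive `t` and `b`, the slope `a / b` is at least `- 1 / t`.
Cone : ℚ → ℚ × ℚ → Set
Cone t (a , b) = 0ℚ ℚ.≤ t ℚ.* a ℚ.+ b

0<1+ : ∀ {t} → 0ℚ ℚ.< t → 0ℚ ℚ.< 1ℚ ℚ.+ t
0<1+ 0<t = ℚ.+-mono-< (ℚ.positive⁻¹ 1ℚ) 0<t

module _ {t} (0<t : 0ℚ ℚ.< t) {a b : ℚ} (0<b : 0ℚ ℚ.< b) (cone : Cone (1ℚ ℚ.+ t) (a , b)) where
  open +-*-Solver

  0<a+b : 0ℚ ℚ.< a ℚ.+ b
  0<a+b = *-cancel-< (0<1+ 0<t) (subst₂ ℚ._<_ (sym (ℚ.*-zeroʳ (1ℚ ℚ.+ t))) (expand t a b)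
    (ℚ.+-mono-≤-< cone (0<* 0<t 0<b)))
    where
    expand : ∀ t a b → (1ℚ ℚ.+ t) ℚ.* a ℚ.+ b ℚ.+ t ℚ.* b ≡ (1ℚ ℚ.+ t) ℚ.* (a ℚ.+ b)
    expand = solve 3 (λ t a b → (con 1ℚ :+ t) :* a :+ b :+ t :* b := (con 1ℚ :+ t) :* (a :+ b)) refl

  -- The map sending `x` to `x / (1 + x)`, increasing for `x > - 1`, takes the bound `- 1 / (1 + t)`
  -- to `- 1 / t`.
  cone-merge : Cone t (merge (a , b) (a , b))
  cone-merge = subst (0ℚ ℚ.≤_) (expand t a b) (0≤* (ℚ.<⇒≤ 0<b) cone)
    where
    expand : ∀ t a b → b ℚ.* ((1ℚ ℚ.+ t) ℚ.* a ℚ.+ b) ≡ t ℚ.* (b ℚ.* a) ℚ.+ (a ℚ.+ b) ℚ.* b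
    expand = solve 3 (λ t a b → b :* ((con 1ℚ :+ t) :* a :+ b) := t :* (b :* a) :+ (a :+ b) :* b) refl

  -- After cancellation, the cross products of the new slopes compare as those of the old ones.
  -- Positivity of `a + b`, which comes from the cone, keeps the second components positive and
  -- ordered.
  ⊏-merge : ∀ {a′ b′} → (a , b) ⊏ (a′ , b′) → merge (a , b) (a , b) ⊏ merge (a′ , b′) (a′ , b′)
  ⊏-merge {a′} {b′} (_ , b≤b′ , ab′<a′b) =
      0<* 0<a+b 0<b
    , ℚ.≤-trans (*-mono-≤ (ℚ.<⇒≤ 0<a+b) b≤b′)
        (ℚ.*-monoʳ-≤-nonNeg b′ {{ℚ.nonNegative (ℚ.<⇒≤ 0<b′)}} (ℚ.<⇒≤ a+b<a′+b′))
    , subst₂ ℚ._<_ (cross a b a′ b′) (cross′ a b a′ b′)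
        (*-mono-< (0<* 0<b 0<b′) (ℚ.+-monoʳ-< (a ℚ.* a′) ab′<a′b))
    where
    0<b′ : 0ℚ ℚ.< b′
    0<b′ = ℚ.<-≤-trans 0<b b≤b′
    a+b<a′+b′ : a ℚ.+ b ℚ.< a′ ℚ.+ b′
    a+b<a′+b′ = *-cancel-< 0<b (begin-strict
      b ℚ.* (a ℚ.+ b)             ≡⟨ ℚ.*-comm b (a ℚ.+ b) ⟩
      (a ℚ.+ b) ℚ.* b             ≤⟨ *-mono-≤ (ℚ.<⇒≤ 0<a+b) b≤b′ ⟩
      (a ℚ.+ b) ℚ.* b′            ≡⟨ ℚ.*-distribʳ-+ b′ a b ⟩
      a ℚ.* b′ ℚ.+ b ℚ.* b′       <⟨ ℚ.+-monoˡ-< (b ℚ.* b′) ab′<a′b ⟩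
      a′ ℚ.* b ℚ.+ b ℚ.* b′       ≡⟨ cong (ℚ._+ b ℚ.* b′) (ℚ.*-comm a′ b) ⟩
      b ℚ.* a′ ℚ.+ b ℚ.* b′       ≡⟨ sym (ℚ.*-distribˡ-+ b a′ b′) ⟩
      b ℚ.* (a′ ℚ.+ b′)           ∎)
      where open ℚ.≤-Reasoning
    cross : ∀ a b a′ b′ →
      b ℚ.* b′ ℚ.* (a ℚ.* a′ ℚ.+ a ℚ.* b′) ≡ b ℚ.* a ℚ.* ((a′ ℚ.+ b′) ℚ.* b′)
    cross = solve 4 (λ a b a′ b′ →
      b :* b′ :* (a :* a′ :+ a :* b′) := b :* a :* ((a′ :+ b′) :* b′)) refl
    cross′ : ∀ a b a′ b′ →
      b ℚ.* b′ ℚ.* (a ℚ.* a′ ℚ.+ a′ ℚ.* b) ≡ b′ ℚ.* a′ ℚ.* ((a ℚ.+ b) ℚ.* b)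
    cross′ = solve 4 (λ a b a′ b′ →
      b :* b′ :* (a :* a′ :+ a′ :* b) := b′ :* a′ :* ((a :+ b) :* b)) refl

shift : ℕ → ℚ → ℚ
shift zero    t = t
shift (suc k) t = 1ℚ ℚ.+ shift k t

0<shift : ∀ k {t} → 0ℚ ℚ.< t → 0ℚ ℚ.< shift k t
0<shift zero    0<t = 0<t
0<shift (suc k) 0<t = 0<1+ (0<shift k 0<t)

shift-mono-≤ : ∀ k {s t} → s ℚ.≤ t → shift k s ℚ.≤ shift k t
shift-mono-≤ zero    s≤t = s≤t
shift-mono-≤ (suc k) s≤t = ℚ.+-monoʳ-≤ 1ℚ (shift-mono-≤ k s≤t)

descend-⊏ : ∀ k {t} → 0ℚ ℚ.< t → ∀ {p p′} → Cone (shift k t) p → p ⊏ p′ →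
  Cone t (descend k p) × descend k p ⊏ descend k p′
descend-⊏ zero    0<t cone p⊏p′ = cone , p⊏p′
descend-⊏ (suc k) 0<t cone p⊏p′@(0<b , _) =
  descend-⊏ k 0<t (cone-merge (0<shift k 0<t) 0<b cone) (⊏-merge (0<shift k 0<t) 0<b cone p⊏p′)

-- One `merge` moves the slope `- 1 / (1 + s)` to `- 1 / s`. Only positivity of the scale `c′` is
-- recorded, since the polynomials evaluated there are homogeneous.
descend-ray : ∀ k t {c} → 0ℚ ℚ.< t → 0ℚ ℚ.< c →
  ∃[ c′ ] (0ℚ ℚ.< c′ × descend k (ℚ.- c , shift k t ℚ.* c) ≡ (ℚ.- c′ , t ℚ.* c′))
descend-ray zero    t {c} 0<t 0<c = c , 0<c , refl
descend-ray (suc k) t {c} 0<t 0<c =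
  let c′ , 0<c′ , eq = descend-ray k t 0<t (0<* (0<* (0<shift (suc k) 0<t) 0<c) 0<c)
  in c′ , 0<c′ , trans (cong (descend k) (cong₂ _,_ (left T c) (right (shift k t) c))) eq
  where
  open +-*-Solver
  T = shift (suc k) t
  left : ∀ T c → T ℚ.* c ℚ.* (ℚ.- c) ≡ ℚ.- (T ℚ.* c ℚ.* c)
  left = solve 2 (λ T c → T :* c :* (:- c) := :- (T :* c :* c)) refl
  right : ∀ s c → (ℚ.- c ℚ.+ (1ℚ ℚ.+ s) ℚ.* c) ℚ.* ((1ℚ ℚ.+ s) ℚ.* c) ≡ s ℚ.* ((1ℚ ℚ.+ s) ℚ.* c ℚ.* c)
  right = solve 2 (λ s c →
    (:- c :+ (con 1ℚ :+ s) :* c) :* ((con 1ℚ :+ s) :* c) := s :* ((con 1ℚ :+ s) :* c :* c)) refl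

module _ (k : ℕ) {t : ℚ} (0<t : 0ℚ ℚ.< t) where
  private
    instance
      shift-pos = ℚ.positive (0<shift k 0<t)
      shift-nonZero = ℚ.pos⇒nonZero (shift k t)

  point : ℚ
  point = ℚ.- (ℚ.1/ shift k t)

  shift*point : shift k t ℚ.* point ≡ ℚ.- 1ℚ
  shift*point = trans (sym (ℚ.neg-distribʳ-* (shift k t) (ℚ.1/ shift k t)))
    (cong ℚ.-_ (ℚ.*-inverseʳ (shift k t)))

  point<0 : point ℚ.< 0ℚ
  point<0 = ℚ.neg-antimono-< (ℚ.positive⁻¹ (ℚ.1/ shift k t) {{ℚ.1/pos⇒pos (shift k t)}})

  descend-point : ∃[ c ] (0ℚ ℚ.< c × descend k (point , 1ℚ) ≡ (ℚ.- c , t ℚ.* c))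
  descend-point = let c , 0<c , eq = descend-ray k t 0<t (ℚ.neg-antimono-< point<0) in
    c , 0<c , trans (cong (descend k) (cong₂ _,_ (neg² (ℚ.1/ shift k t)) (sym shift*-point))) eq
    where
    neg² : ∀ q → ℚ.- q ≡ ℚ.- (ℚ.- (ℚ.- q))
    neg² = solve 1 (λ q → :- q := :- (:- (:- q))) refl
      where open +-*-Solver
    shift*-point : shift k t ℚ.* (ℚ.- point) ≡ 1ℚ
    shift*-point = trans (sym (ℚ.neg-distribʳ-* (shift k t) point)) (cong ℚ.-_ shift*point)

  point≤⇒cone : ∀ {q} → point ℚ.≤ q → Cone (shift k t) (q , 1ℚ)
  point≤⇒cone {q} le = subst (ℚ._≤ shift k t ℚ.* q ℚ.+ 1ℚ)
    (trans (cong (ℚ._+ 1ℚ) shift*point) (ℚ.+-inverseˡ 1ℚ))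
    (ℚ.+-monoˡ-≤ 1ℚ (*-mono-≤ (ℚ.<⇒≤ (0<shift k 0<t)) le))

point-mono-≤ : ∀ k {s t} (0<s : 0ℚ ℚ.< s) (0<t : 0ℚ ℚ.< t) → s ℚ.≤ t → point k 0<s ℚ.≤ point k 0<t
point-mono-≤ k {s} {t} 0<s 0<t s≤t = ℚ.≮⇒≥ λ q<p → ℚ.<-irrefl refl (begin-strict
  ℚ.- 1ℚ                     ≡⟨ sym (shift*point k 0<t) ⟩
  shift k t ℚ.* point k 0<t  <⟨ *-mono-< (0<shift k 0<t) q<p ⟩
  shift k t ℚ.* point k 0<s
    ≤⟨ ℚ.*-monoʳ-≤-nonPos (point k 0<s) {{ℚ.nonPositive (ℚ.<⇒≤ (point<0 k 0<s))}} (shift-mono-≤ k s≤t) ⟩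
  shift k s ℚ.* point k 0<s  ≡⟨ shift*point k 0<s ⟩
  ℚ.- 1ℚ                     ∎)
  where open ℚ.≤-Reasoning

-- Homogeneous forms in two variables

module Homogeneous {X : Set} (_⊕_ _⊗_ : Op₂ X) (_^^_ : X → ℕ → X) where

  -- Horner form of the sum of the terms `cᵢ uⁱ bⁿ⁻ⁱ`.
  form : Vec X (suc n) → X → X → X
  form         (c ∷ [])         u b = c
  form {suc n} (c ∷ cs@(_ ∷ _)) u b = (c ⊗ (b ^^ suc n)) ⊕ (u ⊗ form cs u b)

open Homogeneous ℚ._+_ ℚ._*_ _^ℚ_

^-mono-≤ : ∀ m {p q} → 0ℚ ℚ.≤ p → p ℚ.≤ q → p ^ℚ m ℚ.≤ q ^ℚ m
0≤^ : ∀ m {p} → 0ℚ ℚ.≤ p → 0ℚ ℚ.≤ p ^ℚ m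

0≤^ zero    0≤p = ℚ.nonNegative⁻¹ 1ℚ
0≤^ (suc m) 0≤p = 0≤* 0≤p (0≤^ m 0≤p)

^-mono-≤ zero    0≤p p≤q = ℚ.≤-refl
^-mono-≤ (suc m) {p} {q} 0≤p p≤q = ℚ.≤-trans (*-mono-≤ 0≤p (^-mono-≤ m 0≤p p≤q))
  (ℚ.*-monoʳ-≤-nonNeg (q ^ℚ m) {{ℚ.nonNegative (0≤^ m (ℚ.≤-trans 0≤p p≤q))}} p≤q)

0<^ : ∀ m {p} → 0ℚ ℚ.< p → 0ℚ ℚ.< p ^ℚ m
0<^ zero    0<p = ℚ.positive⁻¹ 1ℚ
0<^ (suc m) 0<p = 0<* 0<p (0<^ m 0<p)

form-scale : ∀ (cs : Vec ℚ (suc n)) s u b → form cs (s ℚ.* u) (s ℚ.* b) ≡ s ^ℚ n ℚ.* form cs u b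
form-scale {zero}  (c ∷ [])         s u b = sym (ℚ.*-identityˡ c)
form-scale {suc n} (c ∷ cs@(_ ∷ _)) s u b = trans
  (cong₂ ℚ._+_ (cong (c ℚ.*_) (^-distrib-* s b (suc n))) (cong (s ℚ.* u ℚ.*_) (form-scale cs s u b)))
  (collect c s u (s ^ℚ n) (b ^ℚ suc n) (form cs u b))
  where
  open +-*-Solver
  collect : ∀ c s u sⁿ bⁿ f →
    c ℚ.* (s ℚ.* sⁿ ℚ.* bⁿ) ℚ.+ s ℚ.* u ℚ.* (sⁿ ℚ.* f) ≡ s ℚ.* sⁿ ℚ.* (c ℚ.* bⁿ ℚ.+ u ℚ.* f)
  collect = solve 6 (λ c s u sⁿ bⁿ f →
    c :* (s :* sⁿ :* bⁿ) :+ s :* u :* (sⁿ :* f) := s :* sⁿ :* (c :* bⁿ :+ u :* f)) refl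

module _ {u b : ℚ} (0≤u : 0ℚ ℚ.≤ u) (0<b : 0ℚ ℚ.< b) where

  0≤form : ∀ {cs : Vec ℚ (suc n)} → All (0ℚ ℚ.≤_) cs → 0ℚ ℚ.≤ form cs u b
  0≤form         (0≤c ∷ [])            = 0≤c
  0≤form {suc n} (0≤c ∷ 0≤cs@(_ ∷ _)) =
    ℚ.+-mono-≤ (0≤* 0≤c (0≤^ (suc n) (ℚ.<⇒≤ 0<b))) (0≤* 0≤u (0≤form 0≤cs))

  0<form : ∀ {c} {cs : Vec ℚ n} → 0ℚ ℚ.< c → All (0ℚ ℚ.≤_) cs → 0ℚ ℚ.< form (c ∷ cs) u b
  0<form         0<c []              = 0<c
  0<form {suc n} 0<c 0≤cs@(_ ∷ _) =
    ℚ.+-mono-<-≤ (0<* 0<c (0<^ (suc n) 0<b)) (0≤* 0≤u (0≤form 0≤cs))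

form-mono-≤ : ∀ {cs : Vec ℚ (suc n)} {u u′ b} → 0ℚ ℚ.≤ u → u ℚ.≤ u′ → 0ℚ ℚ.< b →
  All (0ℚ ℚ.≤_) cs → form cs u b ℚ.≤ form cs u′ b
form-mono-≤         0≤u u≤u′ 0<b (_ ∷ [])             = ℚ.≤-refl
form-mono-≤ {suc n} {c ∷ cs@(_ ∷ _)} {u} {u′} {b} 0≤u u≤u′ 0<b (0≤c ∷ 0≤cs@(_ ∷ _)) =
  ℚ.+-monoʳ-≤ (c ℚ.* b ^ℚ suc n) (ℚ.≤-trans
    (*-mono-≤ 0≤u (form-mono-≤ 0≤u u≤u′ 0<b 0≤cs))
    (ℚ.*-monoʳ-≤-nonNeg (form cs u′ b)
      {{ℚ.nonNegative (0≤form (ℚ.≤-trans 0≤u u≤u′) 0<b 0≤cs)}} u≤u′))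

-- With `b` fixed the `c₀` terms agree, so `c₀` may be negative; the rest is `u` times a positive
-- form that does not decrease as `u` grows.
form-mono-< : ∀ {c₀ c₁} {cs : Vec ℚ n} {u u′ b} → 0ℚ ℚ.≤ u → u ℚ.< u′ → 0ℚ ℚ.< b →
  0ℚ ℚ.< c₁ → All (0ℚ ℚ.≤_) cs → form (c₀ ∷ c₁ ∷ cs) u b ℚ.< form (c₀ ∷ c₁ ∷ cs) u′ b
form-mono-< {n} {c₀} {c₁} {cs} {u} {u′} {b} 0≤u u<u′ 0<b 0<c₁ 0≤cs =
  ℚ.+-monoʳ-< (c₀ ℚ.* b ^ℚ suc n) (ℚ.≤-<-trans
    (*-mono-≤ 0≤u (form-mono-≤ 0≤u (ℚ.<⇒≤ u<u′) 0<b (ℚ.<⇒≤ 0<c₁ ∷ 0≤cs)))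
    (ℚ.*-monoˡ-<-pos (form (c₁ ∷ cs) u′ b)
      {{ℚ.positive (0<form (ℚ.≤-trans 0≤u (ℚ.<⇒≤ u<u′)) 0<b 0<c₁ 0≤cs)}} u<u′))

seq-I-graph : ∀ (c : Code n) → Represents (λ q → eliminateConst c (q , 1ℚ)) (I (graph c))
seq-I-graph c x j = trans (seq-I (graph c) x j) (valueAt≡eliminate c (seq x j))

-- Signs and largest roots of iterated coronas

-- In the coordinates (t a + b , b) only the leading coefficient may be negative,
-- so the tree's polynomial increases to the right of - 1 / t.
record Profile (t : ℚ) (c : Code 8) : Set where
  field
    c₀ c₁   : ℚ
    cs      : Vec ℚ 7
    formula : ∀ a b → eliminateConst c (a , b) ≡ form (c₀ ∷ c₁ ∷ cs) (t ℚ.* a ℚ.+ b) b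
    0<c₁    : 0ℚ ℚ.< c₁
    0≤cs    : All (0ℚ ℚ.≤_) cs

module Tree {t : ℚ} (0<t : 0ℚ ℚ.< t) {c : Code 8} (profile : Profile t c) where
  open Profile profile

  F : ℚ × ℚ → ℚ
  F = eliminateConst c

  pull : ∀ t s a b → t ℚ.* (s ℚ.* a) ℚ.+ s ℚ.* b ≡ s ℚ.* (t ℚ.* a ℚ.+ b)
  pull = solve 4 (λ t s a b → t :* (s :* a) :+ s :* b := s :* (t :* a :+ b)) refl
    where open +-*-Solver

  F-scale : ∀ s a b → F (s ℚ.* a , s ℚ.* b) ≡ s ^ℚ 8 ℚ.* F (a , b)
  F-scale s a b = begin
    F (s ℚ.* a , s ℚ.* b)                                  ≡⟨ formula _ _ ⟩
    form C (t ℚ.* (s ℚ.* a) ℚ.+ s ℚ.* b) (s ℚ.* b)         ≡⟨ cong (λ u → form C u (s ℚ.* b)) (pull t s a b) ⟩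
    form C (s ℚ.* (t ℚ.* a ℚ.+ b)) (s ℚ.* b)               ≡⟨ form-scale C s (t ℚ.* a ℚ.+ b) b ⟩
    s ^ℚ 8 ℚ.* form C (t ℚ.* a ℚ.+ b) b                     ≡⟨ cong (s ^ℚ 8 ℚ.*_) (sym (formula a b)) ⟩
    s ^ℚ 8 ℚ.* F (a , b)                                    ∎
    where
    open ≡-Reasoning
    C = c₀ ∷ c₁ ∷ cs

  F-mono-< : ∀ {a a′ b} → 0ℚ ℚ.< b → Cone t (a , b) → a ℚ.< a′ → F (a , b) ℚ.< F (a′ , b)
  F-mono-< {a} {a′} {b} 0<b cone a<a′ = subst₂ ℚ._<_ (sym (formula a b)) (sym (formula a′ b))
    (form-mono-< {c₀ = c₀} cone (ℚ.+-monoˡ-< b (*-mono-< 0<t a<a′)) 0<b 0<c₁ 0≤cs)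

  -- Scaling both pairs to the common second component `b * b′` reduces the claim to monotonicity in
  -- the first. Nonnegativity of `F p` permits replacing `b ^ 8` by the larger `b′ ^ 8`.
  F-⊏ : ∀ {p p′} → Cone t p → 0ℚ ℚ.≤ F p → p ⊏ p′ → F p ℚ.< F p′
  F-⊏ {a , b} {a′ , b′} cone 0≤F (0<b , b≤b′ , ab′<a′b) = *-cancel-< (0<^ 8 0<b) (begin-strict
    b ^ℚ 8 ℚ.* F (a , b)
      ≤⟨ ℚ.*-monoʳ-≤-nonNeg (F (a , b)) {{ℚ.nonNegative 0≤F}} (^-mono-≤ 8 (ℚ.<⇒≤ 0<b) b≤b′) ⟩
    b′ ^ℚ 8 ℚ.* F (a , b)        ≡⟨ sym (F-scale b′ a b) ⟩
    F (b′ ℚ.* a , b′ ℚ.* b)     <⟨ F-mono-< (0<* 0<b′ 0<b) cone′ b′a<ba′ ⟩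
    F (b ℚ.* a′ , b′ ℚ.* b)     ≡⟨ cong (λ x → F (b ℚ.* a′ , x)) (ℚ.*-comm b′ b) ⟩
    F (b ℚ.* a′ , b ℚ.* b′)     ≡⟨ F-scale b a′ b′ ⟩
    b ^ℚ 8 ℚ.* F (a′ , b′)       ∎)
    where
    open ℚ.≤-Reasoning
    0<b′ : 0ℚ ℚ.< b′
    0<b′ = ℚ.<-≤-trans 0<b b≤b′
    b′a<ba′ : b′ ℚ.* a ℚ.< b ℚ.* a′
    b′a<ba′ = subst₂ ℚ._<_ (ℚ.*-comm a b′) (ℚ.*-comm a′ b) ab′<a′b
    cone′ : Cone t (b′ ℚ.* a , b′ ℚ.* b)
    cone′ = subst (0ℚ ℚ.≤_) (sym (pull t b′ a b)) (0≤* (ℚ.<⇒≤ 0<b′) cone)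

  module _ (k : ℕ) where

    f : ℚ → ℚ
    f q = eliminateConst (coronas k c) (q , 1ℚ)

    increasing : ∀ {p q} → point k 0<t ℚ.≤ p → 0ℚ ℚ.≤ f p → p ℚ.< q → f p ℚ.< f q
    increasing {p} {q} lo≤p 0≤fp p<q =
      let cone , p⊏q = descend-⊏ k 0<t (point≤⇒cone k 0<t lo≤p)
            (ℚ.positive⁻¹ 1ℚ , ℚ.≤-refl , ℚ.*-monoˡ-<-pos 1ℚ p<q)
      in subst₂ ℚ._<_ (sym (eliminate-coronas k c (p , 1ℚ))) (sym (eliminate-coronas k c (q , 1ℚ)))
           (F-⊏ cone (subst (0ℚ ℚ.≤_) (eliminate-coronas k c (p , 1ℚ)) 0≤fp) p⊏q)

    -- The positive factor depends on `k` and `s` but not on the tree, so both signs and comparisons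
    -- between trees can be read off the eight-vertex trees at `- 1 / s`.
    f-point : ∀ {s} (0<s : 0ℚ ℚ.< s) →
      f (point k 0<s) ≡ proj₁ (descend-point k 0<s) ^ℚ 8 ℚ.* F (ℚ.- 1ℚ , s)
    f-point {s} 0<s = let d , _ , eq = descend-point k 0<s in begin
      f (point k 0<s)                      ≡⟨ eliminate-coronas k c (point k 0<s , 1ℚ) ⟩
      F (descend k (point k 0<s , 1ℚ))     ≡⟨ cong F eq ⟩
      F (ℚ.- d , s ℚ.* d)                  ≡⟨ cong F (cong₂ _,_ (neg d) (ℚ.*-comm s d)) ⟩
      F (d ℚ.* (ℚ.- 1ℚ) , d ℚ.* s)         ≡⟨ F-scale d (ℚ.- 1ℚ) s ⟩
      d ^ℚ 8 ℚ.* F (ℚ.- 1ℚ , s)             ∎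
      where
      open ≡-Reasoning
      neg : ∀ d → ℚ.- d ≡ d ℚ.* (ℚ.- 1ℚ)
      neg = solve 1 (λ d → :- d := d :* (:- con 1ℚ)) refl
        where open +-*-Solver

    root : ∀ {s} (0<s : 0ℚ ℚ.< s) → t ℚ.≤ s → F (ℚ.- 1ℚ , t) ℚ.≤ 0ℚ → 0ℚ ℚ.≤ F (ℚ.- 1ℚ , s) →
      ∃[ ξ ] (IsLargestRoot (graph (coronas k c)) ξ × ξ D.≤ fromℚ (point k 0<s))
    root {s} 0<s t≤s Ft≤0 0≤Fs = largestRoot {I (graph (coronas k c))} {f}
      (seq-I-graph (coronas k c))
      (point-mono-≤ k 0<t 0<s t≤s)
      (subst (ℚ._≤ 0ℚ) (sym (f-point 0<t))
        (subst (d ^ℚ 8 ℚ.* F (ℚ.- 1ℚ , t) ℚ.≤_) (ℚ.*-zeroʳ (d ^ℚ 8))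
          (*-mono-≤ (0≤^ 8 (ℚ.<⇒≤ 0<d)) Ft≤0)))
      (subst (0ℚ ℚ.≤_) (sym (f-point 0<s))
        (0≤* (0≤^ 8 (ℚ.<⇒≤ (proj₁ (proj₂ (descend-point k 0<s))))) 0≤Fs))
      increasing
      where
      d = proj₁ (descend-point k 0<t)
      0<d = proj₁ (proj₂ (descend-point k 0<t))

-- The two trees on eight vertices

path : ∀ m → Code (suc m)
path zero    = single
path (suc m) = pendant zero (path m)

-- `tree₂` is a path on five vertices with three more leaves at one end: `4F`, `5F` and `6F` name
-- the same vertex, whose index grows with each new leaf.
tree₁ tree₂ : Code 8
tree₁ = corona (path 3)
tree₂ = pendant 6F (pendant 5F (pendant 4F (path 4)))

-- At `- 1 / t₀ = - 2/7` both polynomials are negative, while the higher coefficients of their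
-- expansions there are nonnegative, as `Profile` demands.
t₀ : ℚ
t₀ = + 7 / 2

module _ where
  open +-*-Solver
  open Homogeneous {Polynomial 2} _:+_ _:*_ _:^_ renaming (form to :form)
  open Elimination {Polynomial 2} _:+_ _:*_ renaming (eliminateConst to :eliminateConst)

  -- The coefficients are those of the expansions in powers of 7x/2 + 1.
  profile₁ : Profile t₀ tree₁
  profile₁ = record
    { c₀      = C₀
    ; c₁      = C₁
    ; cs      = Cs
    ; formula = solve 2 (λ a b → :eliminateConst tree₁ (a , b) :=
        :form (Vec.map con (C₀ ∷ C₁ ∷ Cs)) (con t₀ :* a :+ b) b) refl
    ; 0<c₁    = from-yes (0ℚ ℚ.<? C₁)
    ; 0≤cs    = from-yes (all? (0ℚ ℚ.≤?_) Cs)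
    }
    where
    C₀ = -[1+ 74 ] / 2401
    C₁ = + 440 / 2401
    Cs = + 1188 / 2401 ∷ + 720 / 2401 ∷ + 128 / 2401 ∷ replicate 4 0ℚ

  profile₂ : Profile t₀ tree₂
  profile₂ = record
    { c₀      = C₀
    ; c₁      = C₁
    ; cs      = Cs
    ; formula = solve 2 (λ a b → :eliminateConst tree₂ (a , b) :=
        :form (Vec.map con (C₀ ∷ C₁ ∷ Cs)) (con t₀ :* a :+ b) b) refl
    ; 0<c₁    = from-yes (0ℚ ℚ.<? C₁)
    ; 0≤cs    = from-yes (all? (0ℚ ℚ.≤?_) Cs)
    }
    where
    C₀ = -[1+ 452 ] / 16807
    C₁ = + 2496 / 16807
    Cs = + 9540 / 16807 ∷ + 4152 / 16807 ∷ + 976 / 16807 ∷ + 96 / 16807 ∷ replicate 3 0ℚ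

module _ {t s s′ : ℚ} (0<t : 0ℚ ℚ.< t) (t≤s : t ℚ.≤ s) (s≤s′ : s ℚ.≤ s′) {c d : Code 8} where

  -- eliminateConst c (- 1 , s) is s⁸ times the value at - 1 / s of the polynomial of c.
  ⋠-coronas : Profile t c → Profile t d →
    eliminateConst c (ℚ.- 1ℚ , t) ℚ.≤ 0ℚ → 0ℚ ℚ.≤ eliminateConst c (ℚ.- 1ℚ , s) →
    eliminateConst d (ℚ.- 1ℚ , s′) ℚ.< eliminateConst c (ℚ.- 1ℚ , s′) →
    ∀ k → ¬ graph (coronas k d) ⪯ graph (coronas k c)
  ⋠-coronas profileC profileD ct≤0 0≤cs ds′<cs′ k d⪯c =
    let ξ , isRoot , ξ≤ = C.root k 0<s t≤s ct≤0 0≤cs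
    in <⇒≰ {I (graph (coronas k c))} {I (graph (coronas k d))} {C.f k} {D′.f k}
         (seq-I-graph (coronas k c)) (seq-I-graph (coronas k d)) {q}
         (subst₂ ℚ._<_ (sym (D′.f-point k 0<s′)) (sym (C.f-point k 0<s′))
           (*-mono-< (0<^ 8 (proj₁ (proj₂ (descend-point k 0<s′)))) ds′<cs′))
         -- The comparison point lies in the required interval because `ξ ≤ point k 0<s ≤ q < 0`.
         (d⪯c ξ isRoot (fromℚ q) (≤-fromℚ-trans {ξ} ξ≤ (point-mono-≤ k 0<s 0<s′ s≤s′))
           (fromℚ-mono-≤ (ℚ.<⇒≤ (point<0 k 0<s′))))
    where
    module C  = Tree 0<t profileC
    module D′ = Tree 0<t profileD
    0<s : 0ℚ ℚ.< s
    0<s = ℚ.<-≤-trans 0<t t≤s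
    0<s′ : 0ℚ ℚ.< s′
    0<s′ = ℚ.<-≤-trans 0<s s≤s′
    q = point k 0<s′

theorem4p6 : ∀ (k : ℕ) →
    Σ[ T₁ ∈ Graph (2 ^ (k + 3)) ] Σ[ T₂ ∈ Graph (2 ^ (k + 3)) ]
    (IsTree T₁ × IsTree T₂ × ¬ (T₁ ⪯ T₂) × ¬ (T₂ ⪯ T₁))
theorem4p6 k =
    graph (coronas k tree₁) , graph (coronas k tree₂)
  , code-isTree (coronas k tree₁) , code-isTree (coronas k tree₂)
  -- `F₁ 4ℚ` is zero and `F₂ 4ℚ` positive, so `- 1/4` both bounds the root of `tree₂` and separates
  -- the polynomials.
  , ⋠-coronas 0<t₀ t₀≤4 ℚ.≤-refl profile₂ profile₁
      (from-yes (F₂ t₀ ℚ.≤? 0ℚ)) (from-yes (0ℚ ℚ.≤? F₂ 4ℚ)) (from-yes (F₁ 4ℚ ℚ.<? F₂ 4ℚ)) k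
  -- The first polynomial minus the second is `- x³ (1 + 5x + 3x²)`, which changes sign between
  -- `- 1/4` and `- 1/5`; hence the comparison at 5.
  , ⋠-coronas 0<t₀ t₀≤4 (from-yes (4ℚ ℚ.≤? 5ℚ)) profile₁ profile₂
      (from-yes (F₁ t₀ ℚ.≤? 0ℚ)) (from-yes (0ℚ ℚ.≤? F₁ 4ℚ)) (from-yes (F₂ 5ℚ ℚ.<? F₁ 5ℚ)) k
  where
  F₁ F₂ : ℚ → ℚ
  F₁ s = eliminateConst tree₁ (ℚ.- 1ℚ , s)
  F₂ s = eliminateConst tree₂ (ℚ.- 1ℚ , s)
  4ℚ 5ℚ : ℚ
  4ℚ = + 4 / 1
  5ℚ = + 5 / 1
  0<t₀ : 0ℚ ℚ.< t₀
  0<t₀ = from-yes (0ℚ ℚ.<? t₀)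
  t₀≤4 : t₀ ℚ.≤ 4ℚ
  t₀≤4 = from-yes (t₀ ℚ.≤? 4ℚ)
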